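{- For all integers $\alpha\ge 1$ and $n\ge 0$, $\overline{p}_3\big(3^{2\alpha+1}(3n+2)\big)\equiv 0\pmod{144}$.
   Context: An overpartition of $n$ is a partition of $n$ in which the first occurrence of each distinct part may (or may not) be overlined. An overpartition triple of $n$ is a triple of overpartitions whose parts together sum to $n$. $\overline{p}_3(n)$ denotes the number of overpartition triples of $n$, with $\overline{p}_3(0)=1$; equivalently $\sum_{n\ge0}\overline{p}_3(n)q^n=\big((-q;q)_\infty/(q;q)_\infty\big)^3$, where $(a;q)_\infty=\prod_{n\ge0}(1-aq^n)$. -}

module Defs where

open import Data.Nat using (ℕ; zero; suc; _+_; _*_; _∸_)
open import Data.List using (List; map; upTo)
open import Data.Nat.ListAction using (sum)

-- opb m n : number of overpartitions of n all of whose parts are ≤ m.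
-- Recursion on the largest allowed part m: either part m does not occur,
-- or it occurs j ≥ 1 times (j * m ≤ n), and then its first occurrence is
-- overlined or not (factor 2).
-- 'mult m n k' sums over j = 1 .. k of 2 * opb (m-1) (n - j*m) restricted to j*m ≤ n.
mutual
  opb : ℕ → ℕ → ℕ
  opb zero zero = 1
  opb zero (suc n) = 0
  opb (suc m) n = opb m n + occ m n n

  occ : ℕ → ℕ → ℕ → ℕ
  occ m n zero = 0
  occ m n (suc k) = occ m n k + guard (suc k * suc m) n (2 * opb m (n ∸ (suc k * suc m)))

  guard : ℕ → ℕ → ℕ → ℕ
  guard zero n x = x
  guard (suc a) zero x = 0
  guard (suc a) (suc n) x = guard a n x

pbar : ℕ → ℕ
pbar n = opb n n

conv : (ℕ → ℕ) → (ℕ → ℕ) → ℕ → ℕ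
conv f g n = sum (map (λ i → f i * g (n ∸ i)) (upTo (suc n)))

pbar3 : ℕ → ℕ
pbar3 = conv pbar (conv pbar pbar)

-- Let P = Σ p̄(n) qⁿ and θ = Σ_{k∈ℤ} (-1)^k q^(k²), so that P θ = 1 (Gauss); write U for Σ a(n) qⁿ ↦ Σ a(3n) qⁿ
-- and V for q ↦ q³.
-- Modulo 16, P³ ≡ 2 θ² + θ − 2, and since squares are 0 or 1 modulo 3, U acts as V on θ, on θ² and hence on this series.
-- Modulo 9, M f = U (f³) is multiplicative, because f³ ≡ V f modulo 3. Applied to the product formula for P it gives
-- U (P³) · V P ≡ P⁴; with θ⁹ ≡ (V θ)³ this yields U (P³) ≡ (V P)² θ⁵, U² (P³) ≡ V θ · θ² and U³ (P³) ≡ (V θ)² θ.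
-- In both cases U³ (P³) is congruent to a series fixed by U² and without exponents 2 modulo 3.

module Submission where

open import Defs
open import Algebra using (CommutativeRing; IsCommutativeRing)
open import Data.List using (applyUpTo)
open import Data.List.Properties using (map-applyUpTo)
open import Data.Nat using (ℕ; zero; suc; _≤_; _<_; _∸_; _≤′_; ≤′-refl; ≤′-step; z≤n; s≤s)
  renaming (_+_ to _+ⁿ_; _*_ to _*ⁿ_; _^_ to _^ⁿ_)
open import Data.Nat.DivMod using (_%_; %-distribˡ-+; %-distribˡ-*; m*n%n≡0)
open import Data.Nat.LCM using (lcm-least)
open import Data.Nat.Divisibility using (_∣_; m%n≡0⇒n∣m)
open import Data.Nat.ListAction using (sum)
open import Data.Nat.Properties using (≤-refl; m≤n⇒m≤1+n; [m+n]∸[m+o]≡n∸o)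
open import Data.Product using (∃; _,_; proj₁; proj₂)
open import Induction.WellFounded using (Acc; acc)
open import Level using (0ℓ; _⊔_)
open import Relation.Binary.PropositionalEquality as ≡ using (_≡_; module ≡-Reasoning)
open import Relation.Nullary using (yes; no)
import Algebra.Properties.CommutativeSemiring.Exp as CExp
import Algebra.Properties.Ring as RingProperties
import Algebra.Properties.Semiring.Exp as Exp
import Algebra.Properties.Semiring.Mult as RMult
import Algebra.Properties.Semiring.Mult.TCOptimised as Mult
import Algebra.Solver.Ring.NaturalCoefficients.Default as Solver
import Data.Nat.Induction as ℕ using (<-wellFounded)
import Data.Nat.Properties as ℕ
import Data.Nat.Solver as NatSolver

-- Modulo 16 the point is that t = θ has the form 1 + 2 s. Then 2 t⁵ + t⁴ - 2 t³ - 1 = (t² - 1) (2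
-- t³ + t² + 1), both factors are divisible by 4, and division by t³ gives the formula for P³ = t⁻³.
-- Modulo 9, `M` fixes a factor 1 ± q^k with k prime to 3 and sends 1 ± q^(3j) to (1 ± q^j)³. So M P
-- arises from P when its factors at multiples of 3, which make up V P, are replaced by P³; this is
-- the relation between U (P³), V P and P⁴. The passage to U² (P³) uses that the binomial
-- coefficient 10 in a fifth power is 1 modulo 9. Two obstacles shape the proof. No infinite product
-- or limit is formed: facts about P and θ, including Gauss's identity, are proved for
-- overpartitions with parts at most N and for partial sums of θ, and then read off one coefficient
-- at a time. And 3 cannot be cancelled where 9 = 0, so the congruence f³ ≡ V f modulo 3 has to
-- carry its quotient by 3 explicitly.

-- Stated over an arbitrary ring, so that the ring solver never unfolds the operations on power series.
module Identities {c ℓ} (S : CommutativeRing c ℓ) where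

  open CommutativeRing S
  open RingProperties ring using (+-cancelʳ)
  open Exp semiring using (_^_; ^-congˡ)
  open Mult semiring using () renaming (_×_ to _×′_)
  open Solver commutativeSemiring using (solve; con; _:=_; _:+_; _:*_; _:^_)

  distrib₃ : ∀ v a b c x → v * (a + x * b + x * (x * c)) ≈ v * a + x * (v * b) + x * (x * (v * c))
  distrib₃ = solve 5 (λ v a b c x →
    v :* (a :+ x :* b :+ x :* (x :* c)) := v :* a :+ x :* (v :* b) :+ x :* (x :* (v :* c))) refl

  cube-expand : ∀ a b x →
    (a + x * b) ^ 3 ≈ a * (a * a) + 3 ×′ (a * a * (x * b) + a * (x * b) * (x * b)) + x ^ 3 * b ^ 3
  cube-expand = solve 3 (λ a b x →
    let t = a :* a :* (x :* b) :+ a :* (x :* b) :* (x :* b) in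
    (a :+ x :* b) :^ 3 := a :* (a :* a) :+ (t :+ t :+ t) :+ x :^ 3 :* b :^ 3) refl

  ×3-collect : ∀ a d s r → a + 3 ×′ d + 3 ×′ s + r ≈ a + 3 ×′ (d + s) + r
  ×3-collect = solve 4 (λ a d s r →
    a :+ (d :+ d :+ d) :+ (s :+ s :+ s) :+ r := a :+ ((d :+ s) :+ (d :+ s) :+ (d :+ s)) :+ r) refl

  ×3-factor : ∀ a q v s k → a + q * v + 3 ×′ (s + q * k) ≈ a + 3 ×′ s + q * (v + 3 ×′ k)
  ×3-factor = solve 5 (λ a q v s k →
    a :+ q :* v :+ ((s :+ q :* k) :+ (s :+ q :* k) :+ (s :+ q :* k)) :=
    a :+ (s :+ s :+ s) :+ q :* (v :+ (k :+ k :+ k))) refl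

  ×3-regroup : ∀ v u a b → v + 3 ×′ (u + a + b) ≈ v + 3 ×′ u + 3 ×′ (a + b)
  ×3-regroup = solve 4 (λ v u a b →
    v :+ ((u :+ a :+ b) :+ (u :+ a :+ b) :+ (u :+ a :+ b)) :=
    v :+ (u :+ u :+ u) :+ ((a :+ b) :+ (a :+ b) :+ (a :+ b))) refl

  ninth-power-cubed : ∀ f → f ^ 9 ≈ (f ^ 3) ^ 3
  ninth-power-cubed = solve 1 (λ f → f :^ 9 := (f :^ 3) :^ 3) refl

  cube-of-[v+3k] : ∀ v k →
    (v + 3 ×′ k) ^ 3 ≈ v ^ 3 + 9 ×′ 1# * (v ^ 2 * k + 3 ×′ 1# * v * k ^ 2 + 3 ×′ 1# * k ^ 3)
  cube-of-[v+3k] = solve 2 (λ v k →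
    (v :+ (k :+ k :+ k)) :^ 3 :=
    v :^ 3 :+ con 9 :* (v :^ 2 :* k :+ con 3 :* v :* k :^ 2 :+ con 3 :* k :^ 3)) refl

  cube-* : ∀ f g → (f * g) ^ 3 ≈ f ^ 3 * g ^ 3
  cube-* = solve 2 (λ f g → (f :* g) :^ 3 := f :^ 3 :* g :^ 3) refl

  [a+3s][b+3t] : ∀ a b x h₁ k₁ h₂ k₂ →
    (a + 3 ×′ (x * h₁ + x * (x * k₁))) * (b + 3 ×′ (x * h₂ + x * (x * k₂))) ≈
    a * b + x * (3 ×′ 1# * (a * h₂ + b * h₁)) + x * (x * (3 ×′ 1# * (a * k₂ + b * k₁)))
      + 9 ×′ 1# * ((x * h₁ + x * (x * k₁)) * (x * h₂ + x * (x * k₂)))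
  [a+3s][b+3t] = solve 7 (λ a b x h₁ k₁ h₂ k₂ →
    let m₁ = x :* h₁ :+ x :* (x :* k₁)
        m₂ = x :* h₂ :+ x :* (x :* k₂) in
    (a :+ (m₁ :+ m₁ :+ m₁)) :* (b :+ (m₂ :+ m₂ :+ m₂)) :=
    a :* b :+ x :* (con 3 :* (a :* h₂ :+ b :* h₁)) :+ x :* (x :* (con 3 :* (a :* k₂ :+ b :* k₁)))
      :+ con 9 :* (m₁ :* m₂)) refl

  open import Relation.Binary.Reasoning.Setoid setoid

  -- How hypotheses reach the semiring solver without subtraction: x and y collect multiples of the
  -- two sides of the given equations, chosen so that `f + x ≈ g + y` becomes a polynomial identity.
  modulo : ∀ {f g x y} → x ≈ y → f + x ≈ g + y → f ≈ g
  modulo x≈y p = +-cancelʳ _ _ _ (trans p (+-congˡ (sym x≈y)))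

  telescope-base : ∀ {e} z → 1# + e ≈ 0# → 1# ≈ (1# + z) * 1# + z * 1# + (z + z) * e
  telescope-base {e} z p = modulo (*-congˡ p)
    (solve 2 (λ z e → con 1 :+ (z :+ z) :* (con 1 :+ e) :=
      (con 1 :+ z) :* con 1 :+ z :* con 1 :+ (z :+ z) :* e :+ (z :+ z) :* con 0) refl z e)

  -- The induction step of `B-telescope`: e and e′ are consecutive signs, o and o′ consecutive `O`,
  -- q is the power of X linking them and y a power of z. After q (o′ + o) is replaced by o′ - o,
  -- both sides grow by the same amount e z y (o′ - o).
  telescope-step : ∀ {a b z y e e′ o o′ q} →
    a ≈ (1# + z) * b + z * a + (z + z) * e * o * y → e + e′ ≈ 0# → o′ ≈ o + q * (o′ + o) →
    a + e * (o′ + o) * (q * (z * y)) ≈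
    (1# + z) * (b + e * (o′ + o) * (z * y)) + z * (a + e * (o′ + o) * (q * (z * y))) + (z + z) * e′ * o′ * (z * y)
  telescope-step {a} {b} {z} {y} {e} {e′} {o} {o′} {q} p r s = modulo
    (+-cong (+-cong (sym p) (*-congˡ r)) (+-cong (*-congˡ s) (*-congˡ (sym s))))
    (solve 9 (λ a b z y e e′ o o′ q →
      let t = e :* (o′ :+ o) :* (q :* (z :* y))
          r₁ = (con 1 :+ z) :* b :+ z :* a :+ (z :+ z) :* e :* o :* y
          r₃ = o :+ q :* (o′ :+ o)
          u = (z :+ z) :* z :* y :* o′
          v = e :* z :* y
          w = e :* z :* z :* y in
      a :+ t :+ (r₁ :+ u :* (e :+ e′) :+ (v :* o′ :+ w :* r₃)) :=
      (con 1 :+ z) :* (b :+ e :* (o′ :+ o) :* (z :* y)) :+ z :* (a :+ t) :+ (z :+ z) :* e′ :* o′ :* (z :* y)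
        :+ (a :+ u :* con 0 :+ (v :* r₃ :+ w :* o′))) refl a b z y e e′ o o′ q)

  -- Multiplied by 1 - z, both g and o′ (t + 2 e y) equal (1 + z) (b + 2 e y o). The conclusion
  -- equates these two multiples, with the subtracted terms moved across.
  telescope-close : ∀ {g b z y e e′ o o′ t} →
    g ≈ (1# + z) * (b + e * (o′ + o) * y) + z * g + (z + z) * e′ * o′ * y → e + e′ ≈ 0# →
    o′ ≈ o + z * (o′ + o) → o * t ≈ b →
    o′ * (t + (e * y + e * y)) + z * g ≈ g + z * (o′ * (t + (e * y + e * y)))
  telescope-close {g} {b} {z} {y} {e} {e′} {o} {o′} {t} p r s h = modulo
    (+-cong (+-cong (+-cong p (*-congʳ (sym s))) (+-cong (*-congˡ (sym h)) (*-congˡ r))) (*-congˡ s))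
    (solve 9 (λ g b z y e e′ o o′ t →
      let t′ = t :+ (e :* y :+ e :* y)
          r₁ = (con 1 :+ z) :* (b :+ e :* (o′ :+ o) :* y) :+ z :* g :+ (z :+ z) :* e′ :* o′ :* y
          r₃ = o :+ z :* (o′ :+ o)
          u = (z :+ z) :* o′ :* y in
      o′ :* t′ :+ z :* g :+ (g :+ r₃ :* t′ :+ ((con 1 :+ z) :* b :+ u :* (e :+ e′)) :+ e :* y :* o′) :=
      g :+ z :* (o′ :* t′) :+ (r₁ :+ o′ :* t′ :+ ((con 1 :+ z) :* (o :* t) :+ u :* con 0) :+ e :* y :* r₃))
      refl g b z y e e′ o o′ t)

  double-+ : ∀ a s t → a + ((s + t) + (s + t)) ≈ a + (s + s) + (t + t)
  double-+ = solve 3 (λ a s t → a :+ ((s :+ t) :+ (s :+ t)) := a :+ (s :+ s) :+ (t :+ t)) refl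

  move-factor : ∀ a b d → a * (b * d) ≈ b * (a * d)
  move-factor = solve 3 (λ a b d → a :* (b :* d) := b :* (a :* d)) refl

  trisect-regroup : ∀ v x b s₁ x₁ s₂ x₂ t →
    v + x * b + s₁ * (x * x₁) + s₂ * (x * x₂) + t ≈ v + t + x * (b + (s₁ * x₁ + s₂ * x₂))
  trisect-regroup = solve 8 (λ v x b s₁ x₁ s₂ x₂ t →
    v :+ x :* b :+ s₁ :* (x :* x₁) :+ s₂ :* (x :* x₂) :+ t :=
    v :+ t :+ x :* (b :+ (s₁ :* x₁ :+ s₂ :* x₂))) refl

  double-trisect : ∀ v x b → 1# + ((v + x * b) + (v + x * b)) ≈ 1# + (v + v) + x * (b + b)
  double-trisect = solve 3 (λ v x b →
    con 1 :+ ((v :+ x :* b) :+ (v :+ x :* b)) := con 1 :+ (v :+ v) :+ x :* (b :+ b)) refl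

  square-expand : ∀ a x b → (a + x * b) ^ 2 ≈ a ^ 2 + x * (2 ×′ 1# * (a * b)) + x * (x * (b * b))
  square-expand = solve 3 (λ a x b →
    (a :+ x :* b) :^ 2 := a :^ 2 :+ x :* (con 2 :* (a :* b)) :+ x :* (x :* (b :* b))) refl

  cube-binomial₁ : ∀ e x w → (1# + e * (x * w)) ^ 3 ≈
    1# + e * e * e * (x * w) ^ 3 + x * (3 ×′ 1# * (e * w)) + x * (x * (3 ×′ 1# * (e * e * (w * w))))
  cube-binomial₁ = solve 3 (λ e x w →
    (con 1 :+ e :* (x :* w)) :^ 3 := con 1 :+ e :* e :* e :* (x :* w) :^ 3
      :+ x :* (con 3 :* (e :* w)) :+ x :* (x :* (con 3 :* (e :* e :* (w :* w))))) refl

  cube-binomial₂ : ∀ e x w → (1# + e * (x * (x * w))) ^ 3 ≈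
    1# + e * e * e * (x * (x * w)) ^ 3 + x * (3 ×′ 1# * (e * e * (x ^ 3 * (w * w)))) + x * (x * (3 ×′ 1# * (e * w)))
  cube-binomial₂ = solve 3 (λ e x w →
    (con 1 :+ e :* (x :* (x :* w))) :^ 3 := con 1 :+ e :* e :* e :* (x :* (x :* w)) :^ 3
      :+ x :* (con 3 :* (e :* e :* (x :^ 3 :* (w :* w)))) :+ x :* (x :* (con 3 :* (e :* w)))) refl

  -- The solver knows semirings only, so -1 is an element n with 1 + n = 0. The redundant-looking
  -- `1# * q` matches `binomial 1#`.
  ratio : ∀ {n q o o′} → 1# + n ≈ 0# → o′ ≈ o + q * (o′ + o) → (1# + n * q) * o′ ≈ (1# + 1# * q) * o
  ratio {n} {q} {o} {o′} p r = modulo (+-cong (sym r) (*-congˡ {q * o′} (sym p)))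
    (solve 4 (λ n q o o′ →
      (con 1 :+ n :* q) :* o′ :+ (o :+ q :* (o′ :+ o) :+ q :* o′ :* con 0) :=
      (con 1 :+ con 1 :* q) :* o :+ (o′ :+ q :* o′ :* (con 1 :+ n))) refl n q o o′)

  unratio : ∀ {n q f g} → 1# + n ≈ 0# → (1# + n * q) * f ≈ (1# + n * q) * g → f + q * g ≈ g + q * f
  unratio {n} {q} {f} {g} p r = modulo (+-cong (sym r) (+-cong (*-congˡ {q * f} p) (*-congˡ {q * g} (sym p))))
    (solve 4 (λ n q f g →
      f :+ q :* g :+ ((con 1 :+ n :* q) :* g :+ (q :* f :* (con 1 :+ n) :+ q :* g :* con 0)) :=
      g :+ q :* f :+ ((con 1 :+ n :* q) :* f :+ (q :* f :* con 0 :+ q :* g :* (con 1 :+ n)))) refl n q f g)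

  ratio-chain : ∀ {d₁ d₂ d₃ d₄ n₁ n₂ n₃ n₄ x₀ x₁ x₂ x₃ y y′} →
    d₁ * x₁ ≈ n₁ * x₀ → d₂ * x₂ ≈ n₂ * x₁ → d₃ * x₃ ≈ n₃ * x₂ → d₄ * y′ ≈ n₄ * y →
    d₁ * (d₂ * (d₃ * d₄)) * (x₃ * y′) ≈ n₁ * (n₂ * (n₃ * n₄)) * (x₀ * y)
  ratio-chain {d₁} {d₂} {d₃} {d₄} {n₁} {n₂} {n₃} {n₄} {x₀} {x₁} {x₂} {x₃} {y} {y′} p₁ p₂ p₃ p₄ = begin
    d₁ * (d₂ * (d₃ * d₄)) * (x₃ * y′)
      ≈⟨ solve 6 (λ a b c d x y → a :* (b :* (c :* d)) :* (x :* y) := a :* (b :* (c :* x)) :* (d :* y))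
           refl d₁ d₂ d₃ d₄ x₃ y′ ⟩
    d₁ * (d₂ * (d₃ * x₃)) * (d₄ * y′)
      ≈⟨ *-cong (*-congˡ (*-congˡ p₃)) p₄ ⟩
    d₁ * (d₂ * (n₃ * x₂)) * (n₄ * y)
      ≈⟨ solve 5 (λ a b c x y → a :* (b :* (c :* x)) :* y := a :* (b :* x) :* (c :* y)) refl d₁ d₂ n₃ x₂ (n₄ * y) ⟩
    d₁ * (d₂ * x₂) * (n₃ * (n₄ * y))
      ≈⟨ *-congʳ (*-congˡ p₂) ⟩
    d₁ * (n₂ * x₁) * (n₃ * (n₄ * y))
      ≈⟨ solve 4 (λ a b x y → a :* (b :* x) :* y := a :* x :* (b :* y)) refl d₁ n₂ x₁ (n₃ * (n₄ * y)) ⟩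
    d₁ * x₁ * (n₂ * (n₃ * (n₄ * y)))
      ≈⟨ *-congʳ p₁ ⟩
    n₁ * x₀ * (n₂ * (n₃ * (n₄ * y)))
      ≈⟨ solve 6 (λ a b c d x y → a :* x :* (b :* (c :* (d :* y))) := a :* (b :* (c :* d)) :* (x :* y))
           refl n₁ n₂ n₃ n₄ x₀ y ⟩
    n₁ * (n₂ * (n₃ * n₄)) * (x₀ * y) ∎

  gather : ∀ a b d e f → a * (b * (d * (e * f))) ≈ e * (d * (b * a)) * f
  gather = solve 5 (λ a b d e f → a :* (b :* (d :* (e :* f))) := e :* (d :* (b :* a)) :* f) refl

  cube-nested : ∀ d f → d ^ 3 * f ≈ d * (d * (d * f))
  cube-nested = solve 2 (λ d f → d :^ 3 :* f := d :* (d :* (d :* f))) refl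

  -- The coefficient 10 of a² (x b)³ is split as 1 + 9. Up to that multiple of 9, the terms of
  -- degree 0 and 3 in x are those of a² (a + x b)³; taking its other terms out of the expansion
  -- leaves 2 = 5 - 3 and 7 = 10 - 3.
  fifth-power : ∀ a x b → (a + x * b) ^ 5 ≈
    a ^ 2 * (a + x * b) ^ 3 + 9 ×′ 1# * (a ^ 2 * (x * b) ^ 3)
      + (x * (2 ×′ 1# * (a ^ 4 * b) + 5 ×′ 1# * (a * (x ^ 3 * b ^ 4)))
        + x * (x * (7 ×′ 1# * (a ^ 3 * b ^ 2) + x ^ 3 * b ^ 5)))
  fifth-power = solve 3 (λ a x b →
    (a :+ x :* b) :^ 5 :=
    a :^ 2 :* (a :+ x :* b) :^ 3 :+ con 9 :* (a :^ 2 :* (x :* b) :^ 3)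
      :+ (x :* (con 2 :* (a :^ 4 :* b) :+ con 5 :* (a :* (x :^ 3 :* b :^ 4)))
        :+ x :* (x :* (con 7 :* (a :^ 3 :* b :^ 2) :+ x :^ 3 :* b :^ 5)))) refl

  M-θ-from-M-P : ∀ {p t m n v} → p * t ≈ 1# → n * m ≈ 1# → m * v ≈ p * p ^ 3 → n ≈ t ^ 4 * v
  M-θ-from-M-P {p} {t} {m} {n} {v} pt nm mv = begin
    n                       ≈⟨ solve 1 (λ n → n := n :* con 1 :^ 4) refl n ⟩
    n * 1# ^ 4              ≈⟨ *-congˡ (^-congˡ 4 (sym pt)) ⟩
    n * (p * t) ^ 4         ≈⟨ solve 3 (λ n p t → n :* (p :* t) :^ 4 := n :* (p :* p :^ 3) :* t :^ 4) refl n p t ⟩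
    n * (p * p ^ 3) * t ^ 4 ≈⟨ *-congʳ (*-congˡ (sym mv)) ⟩
    n * (m * v) * t ^ 4     ≈⟨ solve 4 (λ n m v t → n :* (m :* v) :* t :^ 4 := n :* m :* (t :^ 4 :* v)) refl n m v t ⟩
    n * m * (t ^ 4 * v)     ≈⟨ *-congʳ nm ⟩
    1# * (t ^ 4 * v)        ≈⟨ *-identityˡ _ ⟩
    t ^ 4 * v               ∎

  -- Multiplying by (v a)⁴ = 1 supplies both the factor v that turns m into p⁴ and the cube a³ that
  -- can be traded for t⁹.
  M-P-reduced : ∀ {p t m v a} → p * t ≈ 1# → v * a ≈ 1# → t ^ 9 ≈ a ^ 3 → m * v ≈ p * p ^ 3 → m ≈ v ^ 2 * t ^ 5
  M-P-reduced {p} {t} {m} {v} {a} pt va t⁹ mv = begin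
    m                               ≈⟨ solve 1 (λ m → m := m :* con 1 :^ 4) refl m ⟩
    m * 1# ^ 4                      ≈⟨ *-congˡ (^-congˡ 4 (sym va)) ⟩
    m * (v * a) ^ 4                 ≈⟨ solve 3 (λ m v a → m :* (v :* a) :^ 4 := m :* v :* (v :^ 3 :* (a :^ 3 :* a))) refl m v a ⟩
    m * v * (v ^ 3 * (a ^ 3 * a))   ≈⟨ *-cong mv (*-congˡ (*-congʳ (sym t⁹))) ⟩
    p * p ^ 3 * (v ^ 3 * (t ^ 9 * a))
      ≈⟨ solve 4 (λ p t v a → p :* p :^ 3 :* (v :^ 3 :* (t :^ 9 :* a)) 
           := (p :* t) :^ 4 :* (v :* a) :* (v :^ 2 :* t :^ 5)) refl p t v a ⟩
    (p * t) ^ 4 * (v * a) * (v ^ 2 * t ^ 5)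
      ≈⟨ *-congʳ (*-cong (^-congˡ 4 pt) va) ⟩
    1# ^ 4 * 1# * (v ^ 2 * t ^ 5)   ≈⟨ solve 1 (λ w → con 1 :^ 4 :* con 1 :* w := w) refl (v ^ 2 * t ^ 5) ⟩
    v ^ 2 * t ^ 5                   ∎

  U²-reduced : ∀ {p t v a} → p * t ≈ 1# → v * a ≈ 1# → p ^ 2 * (a ^ 2 * (t ^ 4 * v)) ≈ a * t ^ 2
  U²-reduced {p} {t} {v} {a} pt va = begin
    p ^ 2 * (a ^ 2 * (t ^ 4 * v))
      ≈⟨ solve 4 (λ p t v a → p :^ 2 :* (a :^ 2 :* (t :^ 4 :* v)) := (p :* t) :^ 2 :* (v :* a) :* (a :* t :^ 2)) refl p t v a ⟩
    (p * t) ^ 2 * (v * a) * (a * t ^ 2) ≈⟨ *-congʳ (*-cong (^-congˡ 2 pt) va) ⟩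
    1# ^ 2 * 1# * (a * t ^ 2)           ≈⟨ solve 1 (λ w → con 1 :^ 2 :* con 1 :* w := w) refl (a * t ^ 2) ⟩
    a * t ^ 2                           ∎

  -- With t = 1 + 2 s, the polynomial r below satisfies 2 t⁵ + t⁴ = 1 + 2 t³ + 16 r.
  cube-mod-16 : ∀ {p s n} → 1# + n ≈ 0# → (∀ f → 16 ×′ 1# * f ≈ 0#) → p * (1# + (s + s)) ≈ 1# →
    p ^ 3 ≈ (1# + (s + s)) + 2 ×′ 1# * (1# + (s + s)) ^ 2 + 2 ×′ 1# * n
  cube-mod-16 {p} {s} {n} n≈-1 16≈0 pt = modulo
    (+-cong (+-cong (*-congˡ {2 ×′ 1#} (^-congˡ 3 pt)) (16≈0 (p ^ 3 * r))) (*-congˡ {2 ×′ 1#} n≈-1))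
    (begin
      p ^ 3 + (2 ×′ 1# * (p * t) ^ 3 + 16 ×′ 1# * (p ^ 3 * r) + 2 ×′ 1# * (1# + n))
        ≈⟨ solve 3 (λ p s n →
             let t = con 1 :+ (s :+ s)
                 r = s :+ con 5 :* s :^ 2 :+ con 11 :* s :^ 3 :+ con 11 :* s :^ 4 :+ con 4 :* s :^ 5 in
             p :^ 3 :+ (con 2 :* (p :* t) :^ 3 :+ con 16 :* (p :^ 3 :* r) :+ con 2 :* (con 1 :+ n)) :=
             (p :* t) :^ 3 :* (t :+ con 2 :* t :^ 2) :+ con 2 :* (con 1 :+ n)) refl p s n ⟩
      (p * t) ^ 3 * (t + 2 ×′ 1# * t ^ 2) + 2 ×′ 1# * (1# + n)
        ≈⟨ +-congʳ (*-congʳ (^-congˡ 3 pt)) ⟩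
      1# ^ 3 * (t + 2 ×′ 1# * t ^ 2) + 2 ×′ 1# * (1# + n)
        ≈⟨ solve 2 (λ t n → con 1 :^ 3 :* (t :+ con 2 :* t :^ 2) :+ con 2 :* (con 1 :+ n) :=
             t :+ con 2 :* t :^ 2 :+ con 2 :* n :+ (con 2 :* con 1 :^ 3 :+ con 0 :+ con 2 :* con 0)) refl t n ⟩
      t + 2 ×′ 1# * t ^ 2 + 2 ×′ 1# * n + (2 ×′ 1# * 1# ^ 3 + 0# + 2 ×′ 1# * 0#) ∎)
    where
    t r : Carrier
    t = 1# + (s + s)
    r = s + 5 ×′ 1# * s ^ 2 + 11 ×′ 1# * s ^ 3 + 11 ×′ 1# * s ^ 4 + 4 ×′ 1# * s ^ 5

-- The ring of formal power series

module PowerSeries {c ℓ} (R : CommutativeRing c ℓ) where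

  private
    module R = CommutativeRing R
  open R using (Carrier; 0#; 1#)
  open import Relation.Binary.Reasoning.Setoid R.setoid

  Series : Set c
  Series = ℕ → Carrier

  infix 4 _≋_
  -- A record, so that unification recovers `f` and `g` from an equation.
  record _≋_ (f g : Series) : Set ℓ where
    constructor coeffwise
    field at : ∀ n → f n R.≈ g n
  open _≋_ public

  tail : Series → Series
  tail f n = f (suc n)

  infixl 6 _⊕_
  infixl 7 _⊛_

  opaque
    _⊕_ : Series → Series → Series
    (f ⊕ g) n = f n R.+ g n

  opaque
    _⊛_ : Series → Series → Series
    (f ⊛ g) zero    = f 0 R.* g 0
    (f ⊛ g) (suc n) = f 0 R.* g (suc n) R.+ (tail f ⊛ g) n

  opaque
    ⊖_ : Series → Series
    (⊖ f) n = R.- f n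

  opaque
    unfolding _⊕_

    ⊕-coeff : ∀ f g n → (f ⊕ g) n R.≈ f n R.+ g n
    ⊕-coeff f g n = R.refl

  0ₛ : Series
  0ₛ n = 0#

  const : Carrier → Series
  const x zero    = x
  const x (suc n) = 0#

  X : Series
  X zero    = 0#
  X (suc n) = const 1# n

  opaque
    unfolding _⊕_ _⊛_ ⊖_

    -- Coefficient n of a product involves only coefficients up to n. The bounded form also serves
    -- for products of truncated series.
    ⊛-cong-≤ : ∀ {f f′ g g′} n → (∀ {i} → i ≤ n → f i R.≈ f′ i) → (∀ {i} → i ≤ n → g i R.≈ g′ i) →
               (f ⊛ g) n R.≈ (f′ ⊛ g′) n
    ⊛-cong-≤ zero    p r = R.*-cong (p z≤n) (r z≤n)
    ⊛-cong-≤ (suc n) p r =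
      R.+-cong (R.*-cong (p z≤n) (r ≤-refl))
               (⊛-cong-≤ n (λ i≤n → p (s≤s i≤n)) (λ i≤n → r (m≤n⇒m≤1+n i≤n)))

    -- `_⊛_` consumes its left factor; commutativity requires the same recursion on the right one.
    ⊛-suc : ∀ f g n → (f ⊛ g) (suc n) R.≈ (f ⊛ tail g) n R.+ f (suc n) R.* g 0
    ⊛-suc f g zero    = R.refl
    ⊛-suc f g (suc n) = R.trans (R.+-congˡ (⊛-suc (tail f) g n)) (R.sym (R.+-assoc _ _ _))

    ⊛-comm : ∀ f g n → (f ⊛ g) n R.≈ (g ⊛ f) n
    ⊛-comm f g zero    = R.*-comm _ _
    ⊛-comm f g (suc n) = begin
      f 0 R.* g (suc n) R.+ (tail f ⊛ g) n  ≈⟨ R.+-cong (R.*-comm _ _) (⊛-comm (tail f) g n) ⟩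
      g (suc n) R.* f 0 R.+ (g ⊛ tail f) n  ≈⟨ R.+-comm _ _ ⟩
      (g ⊛ tail f) n R.+ g (suc n) R.* f 0  ≈⟨ ⊛-suc g f n ⟨
      (g ⊛ f) (suc n)                       ∎

    +-interchange : ∀ w x y z → (w R.+ x) R.+ (y R.+ z) R.≈ (w R.+ y) R.+ (x R.+ z)
    +-interchange w x y z = begin
      (w R.+ x) R.+ (y R.+ z)  ≈⟨ R.+-assoc _ _ _ ⟩
      w R.+ (x R.+ (y R.+ z))  ≈⟨ R.+-congˡ (R.+-assoc _ _ _) ⟨
      w R.+ ((x R.+ y) R.+ z)  ≈⟨ R.+-congˡ (R.+-congʳ (R.+-comm x y)) ⟩
      w R.+ ((y R.+ x) R.+ z)  ≈⟨ R.+-congˡ (R.+-assoc _ _ _) ⟩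
      w R.+ (y R.+ (x R.+ z))  ≈⟨ R.+-assoc _ _ _ ⟨
      (w R.+ y) R.+ (x R.+ z)  ∎

    ⊛-distribʳ : ∀ h f g n → ((f ⊕ g) ⊛ h) n R.≈ (f ⊛ h) n R.+ (g ⊛ h) n
    ⊛-distribʳ h f g zero    = R.distribʳ _ _ _
    ⊛-distribʳ h f g (suc n) =
      R.trans (R.+-cong (R.distribʳ _ _ _) (⊛-distribʳ h (tail f) (tail g) n)) (+-interchange _ _ _ _)

    ⊛-scale : ∀ x f g n → ((λ i → x R.* f i) ⊛ g) n R.≈ x R.* (f ⊛ g) n
    ⊛-scale x f g zero    = R.*-assoc _ _ _
    ⊛-scale x f g (suc n) =
      R.trans (R.+-cong (R.*-assoc _ _ _) (⊛-scale x (tail f) g n)) (R.sym (R.distribˡ _ _ _))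

    ⊛-assoc : ∀ f g h n → ((f ⊛ g) ⊛ h) n R.≈ (f ⊛ (g ⊛ h)) n
    ⊛-assoc f g h zero    = R.*-assoc _ _ _
    ⊛-assoc f g h (suc n) = begin
      f 0 R.* g 0 R.* h (suc n) R.+ (((λ i → f 0 R.* g (suc i)) ⊕ (tail f ⊛ g)) ⊛ h) n
        ≈⟨ R.+-congˡ (⊛-distribʳ h _ _ n) ⟩
      f 0 R.* g 0 R.* h (suc n) R.+ (((λ i → f 0 R.* g (suc i)) ⊛ h) n R.+ ((tail f ⊛ g) ⊛ h) n)
        ≈⟨ R.+-cong (R.*-assoc _ _ _) (R.+-cong (⊛-scale _ _ h n) (⊛-assoc (tail f) g h n)) ⟩
      f 0 R.* (g 0 R.* h (suc n)) R.+ (f 0 R.* (tail g ⊛ h) n R.+ (tail f ⊛ (g ⊛ h)) n)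
        ≈⟨ R.+-assoc _ _ _ ⟨
      f 0 R.* (g 0 R.* h (suc n)) R.+ f 0 R.* (tail g ⊛ h) n R.+ (tail f ⊛ (g ⊛ h)) n
        ≈⟨ R.+-congʳ (R.distribˡ _ _ _) ⟨
      (f ⊛ (g ⊛ h)) (suc n) ∎

    0ₛ-⊛ : ∀ f n → (0ₛ ⊛ f) n R.≈ 0#
    0ₛ-⊛ f zero    = R.zeroˡ _
    0ₛ-⊛ f (suc n) = R.trans (R.+-cong (R.zeroˡ _) (0ₛ-⊛ f n)) (R.+-identityʳ _)

    const-⊛ : ∀ x f n → (const x ⊛ f) n R.≈ x R.* f n
    const-⊛ x f zero    = R.refl
    const-⊛ x f (suc n) = R.trans (R.+-congˡ (0ₛ-⊛ f n)) (R.+-identityʳ _)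

    1ₛ-⊛ : ∀ f n → (const 1# ⊛ f) n R.≈ f n
    1ₛ-⊛ f n = R.trans (const-⊛ 1# f n) (R.*-identityˡ _)

    X-⊛-zero : ∀ f → (X ⊛ f) 0 R.≈ 0#
    X-⊛-zero f = R.zeroˡ _

    X-⊛-suc : ∀ f n → (X ⊛ f) (suc n) R.≈ f n
    X-⊛-suc f n = R.trans (R.+-cong (R.zeroˡ _) (1ₛ-⊛ f n)) (R.+-identityˡ _)

    isCommutativeRing : IsCommutativeRing _≋_ _⊕_ _⊛_ ⊖_ 0ₛ (const 1#)
    isCommutativeRing = record
      { isRing = record
        { +-isAbelianGroup = record
          { isGroup = record
            { isMonoid = record
              { isSemigroup = record
                { isMagma = record
                  { isEquivalence = record
                    { refl  = coeffwise λ _ → R.refl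
                    ; sym   = λ p → coeffwise λ n → R.sym (at p n)
                    ; trans = λ p r → coeffwise λ n → R.trans (at p n) (at r n)
                    }
                  ; ∙-cong = λ p r → coeffwise λ n → R.+-cong (at p n) (at r n)
                  }
                ; assoc = λ f g h → coeffwise λ n → R.+-assoc _ _ _
                }
              ; identity = (λ f → coeffwise λ n → R.+-identityˡ _) , (λ f → coeffwise λ n → R.+-identityʳ _)
              }
            ; inverse = (λ f → coeffwise λ n → R.-‿inverseˡ _) , (λ f → coeffwise λ n → R.-‿inverseʳ _)
            ; ⁻¹-cong = λ p → coeffwise λ n → R.-‿cong (at p n)
            }
          ; comm = λ f g → coeffwise λ n → R.+-comm _ _
          }
        ; *-cong = λ p r → coeffwise λ n → ⊛-cong-≤ n (λ {i} _ → at p i) (λ {i} _ → at r i)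
        ; *-assoc = λ f g h → coeffwise (⊛-assoc f g h)
        ; *-identity = (λ f → coeffwise (1ₛ-⊛ f)) ,
                       (λ f → coeffwise λ n → R.trans (⊛-comm f _ n) (1ₛ-⊛ f n))
        ; distrib = (λ h f g → coeffwise λ n →
                       R.trans (⊛-comm h _ n) (R.trans (⊛-distribʳ h f g n) (R.+-cong (⊛-comm f h n) (⊛-comm g h n)))) ,
                    (λ h f g → coeffwise (⊛-distribʳ h f g))
        }
      ; *-comm = λ f g → coeffwise (⊛-comm f g)
      }

  series : CommutativeRing c ℓ
  series = record { isCommutativeRing = isCommutativeRing }

-- Exponents modulo 3: the operators `U` and `V`

module Trisection {c ℓ} (R : CommutativeRing c ℓ) where

  private
    module R = CommutativeRing R
  open PowerSeries R
  open CommutativeRing series hiding (zero)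
  open Exp semiring using (_^_; ^-congˡ; ^-assocʳ)
  open RingProperties ring using (+-inverseˡ-unique)
  open import Relation.Binary.Reasoning.Setoid setoid
  open Mult semiring using () renaming (_×_ to _×′_)

  V : Series → Series
  V f 0 = f 0
  V f 1 = R.0#
  V f 2 = R.0#
  V f (suc (suc (suc n))) = V (tail f) n

  section : ℕ → Series → Series
  section r f n = f (r +ⁿ n *ⁿ 3)

  U : Series → Series
  U = section 0

  opaque
    unfolding _⊕_

    U-+ : ∀ f g → U (f + g) ≈ U f + U g
    U-+ f g = coeffwise λ _ → R.refl

  U-cong : ∀ {f g} → f ≈ g → U f ≈ U g
  U-cong p = coeffwise λ n → at p (n *ⁿ 3)

  V-coeff-cong : ∀ f g n → (∀ {i} → i ≤ n → f i R.≈ g i) → V f n R.≈ V g n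
  V-coeff-cong f g 0 p = p z≤n
  V-coeff-cong f g 1 p = R.refl
  V-coeff-cong f g 2 p = R.refl
  V-coeff-cong f g (suc (suc (suc n))) p =
    V-coeff-cong (tail f) (tail g) n (λ i≤n → p (s≤s (m≤n⇒m≤1+n (m≤n⇒m≤1+n i≤n))))

  V-cong : ∀ {f g} → f ≈ g → V f ≈ V g
  V-cong p = coeffwise λ n → V-coeff-cong _ _ n (λ {i} _ → at p i)

  opaque
    unfolding _⊕_

    V-+ : ∀ f g → V (f + g) ≈ V f + V g
    V-+ f g = coeffwise (go f g)
      where
      go : ∀ f g n → V (f + g) n R.≈ V f n R.+ V g n
      go f g 0 = R.refl
      go f g 1 = R.sym (R.+-identityʳ _)
      go f g 2 = R.sym (R.+-identityʳ _)
      go f g (suc (suc (suc n))) = go (tail f) (tail g) n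

  V-0 : V 0# ≈ 0#
  V-0 = coeffwise go
    where
    go : ∀ n → V 0# n R.≈ R.0#
    go 0 = R.refl
    go 1 = R.refl
    go 2 = R.refl
    go (suc (suc (suc n))) = go n

  V-const : ∀ x → V (const x) ≈ const x
  V-const x = coeffwise λ where
    0 → R.refl
    1 → R.refl
    2 → R.refl
    (suc (suc (suc n))) → at V-0 n

  opaque
    unfolding _⊕_ _⊛_

    V-* : ∀ f g → V (f * g) ≈ V f * V g
    V-* f g = coeffwise (go f g)
      where
      scale : ∀ x f n → V (λ i → x R.* f i) n R.≈ x R.* V f n
      scale x f 0 = R.refl
      scale x f 1 = R.sym (R.zeroʳ x)
      scale x f 2 = R.sym (R.zeroʳ x)
      scale x f (suc (suc (suc n))) = scale x (tail f) n
      go : ∀ f g n → V (f * g) n R.≈ (V f * V g) n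
      go f g 0 = R.refl
      go f g 1 = R.sym (R.trans (R.+-cong (R.zeroʳ _) (R.zeroˡ _)) (R.+-identityʳ _))
      go f g 2 = R.sym (R.trans (R.+-cong (R.zeroʳ _) (R.trans (R.+-cong (R.zeroˡ _) (R.zeroˡ _)) (R.+-identityʳ _)))
                                (R.+-identityʳ _))
      go f g (suc (suc (suc n))) =
        R.trans (at (V-+ (λ i → f 0 R.* g (suc i)) (tail f * g)) n)
        (R.+-cong (scale (f 0) (tail g) n)
        (R.trans (go (tail f) g n)
        (R.sym (R.trans (R.+-cong (R.zeroˡ _) (R.trans (R.+-cong (R.zeroˡ _) R.refl) (R.+-identityˡ _)))
                        (R.+-identityˡ _)))))

  V-^ : ∀ f k → V (f ^ k) ≈ V f ^ k
  V-^ f zero    = V-const R.1#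
  V-^ f (suc k) = trans (V-* f (f ^ k)) (*-congˡ (V-^ f k))

  V-X : V X ≈ X ^ 3
  V-X = coeffwise λ where
      0 → R.sym (at X³ 0)
      1 → R.sym (at X³ 1)
      2 → R.sym (at X³ 2)
      (suc (suc (suc n))) → R.trans (at (V-const R.1#) n) (R.sym (at X³ (suc (suc (suc n)))))
    where
    shift : Series → Series
    shift f zero    = R.0#
    shift f (suc n) = f n
    X-shift : ∀ f → X * f ≈ shift f
    X-shift f = coeffwise λ { zero → X-⊛-zero f ; (suc n) → X-⊛-suc f n }
    shift-cong : ∀ {f g} → f ≈ g → shift f ≈ shift g
    shift-cong p = coeffwise λ { zero → R.refl ; (suc n) → at p n }
    X³ : X ^ 3 ≈ shift (shift (shift 1#))
    X³ = trans (X-shift _) (shift-cong (trans (X-shift _) (shift-cong (X-shift _))))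

  U-V : ∀ f → U (V f) ≈ f
  U-V f = coeffwise (go f)
    where
    go : ∀ f n → V f (n *ⁿ 3) R.≈ f n
    go f zero    = R.refl
    go f (suc n) = go (tail f) n

  XV-coeff : ∀ f n → (X * V f) (3 +ⁿ n) R.≈ (X * V (tail f)) n
  XV-coeff f zero    = R.trans (X-⊛-suc (V f) 2) (R.sym (X-⊛-zero (V (tail f))))
  XV-coeff f (suc n) = R.trans (X-⊛-suc (V f) (3 +ⁿ n)) (R.sym (X-⊛-suc _ n))

  XXV-coeff : ∀ f n → (X * (X * V f)) (3 +ⁿ n) R.≈ (X * (X * V (tail f))) n
  XXV-coeff f zero    =
    R.trans (X-⊛-suc (X * V f) 2) (R.trans (X-⊛-suc (V f) 1) (R.sym (X-⊛-zero (X * V (tail f)))))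
  XXV-coeff f (suc n) =
    R.trans (X-⊛-suc (X * V f) (3 +ⁿ n)) (R.trans (XV-coeff f n) (R.sym (X-⊛-suc _ n)))

  U-XV : ∀ f → U (X * V f) ≈ 0#
  U-XV f = coeffwise (go f)
    where
    go : ∀ f n → (X * V f) (n *ⁿ 3) R.≈ R.0#
    go f zero    = X-⊛-zero (V f)
    go f (suc n) = R.trans (XV-coeff f (n *ⁿ 3)) (go (tail f) n)

  U-XXV : ∀ f → U (X * (X * V f)) ≈ 0#
  U-XXV f = coeffwise (go f)
    where
    go : ∀ f n → (X * (X * V f)) (n *ⁿ 3) R.≈ R.0#
    go f zero    = X-⊛-zero (X * V f)
    go f (suc n) = R.trans (XXV-coeff f (n *ⁿ 3)) (go (tail f) n)

  opaque
    unfolding _⊕_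

    trisect : (f : Series) → f ≈ V (U f) + X * V (section 1 f) + X * (X * V (section 2 f))
    trisect f = coeffwise (go f)
      where
      go : ∀ f n → f n R.≈ V (U f) n R.+ (X * V (section 1 f)) n R.+ (X * (X * V (section 2 f))) n
      go f 0 = R.sym (R.trans (R.+-cong (R.trans (R.+-congˡ (X-⊛-zero (V (section 1 f)))) (R.+-identityʳ _))
                                        (X-⊛-zero (X * V (section 2 f))))
                              (R.+-identityʳ _))
      go f 1 = R.sym (R.trans (R.+-cong (R.trans (R.+-congˡ (X-⊛-suc (V (section 1 f)) 0)) (R.+-identityˡ _))
                                        (R.trans (X-⊛-suc (X * V (section 2 f)) 0) (X-⊛-zero (V (section 2 f)))))
                              (R.+-identityʳ _))
      go f 2 = R.sym (R.trans (R.+-cong (R.trans (R.+-congˡ (X-⊛-suc (V (section 1 f)) 1)) (R.+-identityˡ _))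
                                        (R.trans (X-⊛-suc (X * V (section 2 f)) 1) (X-⊛-suc (V (section 2 f)) 0)))
                              (R.+-identityˡ _))
      go f (suc (suc (suc n))) =
        R.trans (go (λ i → f (3 +ⁿ i)) n)
                (R.sym (R.+-cong (R.+-congˡ (XV-coeff (section 1 f) n)) (XXV-coeff (section 2 f) n)))

  Cubic : Series → Set (c ⊔ ℓ)
  Cubic f = ∃ λ g → f ≈ V g

  cubic-V : ∀ f → Cubic (V f)
  cubic-V f = f , refl

  cubic-+ : ∀ {f g} → Cubic f → Cubic g → Cubic (f + g)
  cubic-+ (f′ , p) (g′ , r) = f′ + g′ , trans (+-cong p r) (sym (V-+ f′ g′))

  cubic-* : ∀ {f g} → Cubic f → Cubic g → Cubic (f * g)
  cubic-* (f′ , p) (g′ , r) = f′ * g′ , trans (*-cong p r) (sym (V-* f′ g′))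

  cubic-1 : Cubic 1#
  cubic-1 = 1# , sym (V-const R.1#)

  cubic-^ : ∀ {f} k → Cubic f → Cubic (f ^ k)
  cubic-^ zero    p = cubic-1
  cubic-^ (suc k) p = cubic-* p (cubic-^ k p)

  cubic-X³ : Cubic (X ^ 3)
  cubic-X³ = X , sym V-X

  cubic-ℕ : ∀ k → Cubic (k ×′ 1#)
  cubic-ℕ 0             = 0# , sym V-0
  cubic-ℕ 1             = cubic-1
  cubic-ℕ (suc (suc k)) = cubic-+ (cubic-ℕ (suc k)) cubic-1

  -- With h and k series in q³, the last two summands live on exponents 1 and 2 modulo 3, which `U`
  -- discards. Most evaluations of `U` consist in bringing a series into this shape.
  U-cubic : ∀ {f g h k} → f ≈ V g + X * h + X * (X * k) → Cubic h → Cubic k → U f ≈ g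
  U-cubic {f} {g} {h} {k} p (h′ , q) (k′ , r) = begin
    U f                                             ≈⟨ U-cong (trans p (+-cong (+-congˡ (*-congˡ q)) (*-congˡ (*-congˡ r)))) ⟩
    U (V g + X * V h′ + X * (X * V k′))             ≈⟨ trans (U-+ _ _) (+-congʳ (U-+ _ _)) ⟩
    U (V g) + U (X * V h′) + U (X * (X * V k′))     ≈⟨ +-cong (+-cong (U-V g) (U-XV h′)) (U-XXV k′) ⟩
    g + 0# + 0#                                     ≈⟨ trans (+-identityʳ _) (+-identityʳ _) ⟩
    g                                               ∎

  U-V-* : ∀ f g → U (V f * g) ≈ f * U g
  U-V-* f g = U-cubic expand (cubic-* (cubic-V f) (cubic-V (section 1 g))) (cubic-* (cubic-V f) (cubic-V (section 2 g)))
    where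
    expand : V f * g ≈ V (f * U g) + X * (V f * V (section 1 g)) + X * (X * (V f * V (section 2 g)))
    expand = begin
      V f * g
        ≈⟨ *-congˡ (trisect g) ⟩
      V f * (V (U g) + X * V (section 1 g) + X * (X * V (section 2 g)))
        ≈⟨ Identities.distrib₃ series _ _ _ _ _ ⟩
      V f * V (U g) + X * (V f * V (section 1 g)) + X * (X * (V f * V (section 2 g)))
        ≈⟨ +-congʳ (+-congʳ (V-* f (U g))) ⟨
      V (f * U g) + X * (V f * V (section 1 g)) + X * (X * (V f * V (section 2 g))) ∎

  X^-coeff : ∀ k f n → (X ^ k * f) (k +ⁿ n) R.≈ f n
  X^-coeff zero    f n = at (*-identityˡ f) n
  X^-coeff (suc k) f n = R.trans (at (*-assoc X (X ^ k) f) (suc k +ⁿ n))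
                         (R.trans (X-⊛-suc (X ^ k * f) (k +ⁿ n)) (X^-coeff k f n))

  X^-coeff-< : ∀ {k i} f → i < k → (X ^ k * f) i R.≈ R.0#
  X^-coeff-< {suc k} {zero}  f _         = R.trans (at (*-assoc X (X ^ k) f) 0) (X-⊛-zero (X ^ k * f))
  X^-coeff-< {suc k} {suc i} f (s≤s i<k) =
    R.trans (at (*-assoc X (X ^ k) f) (suc i)) (R.trans (X-⊛-suc (X ^ k * f) i) (X^-coeff-< f i<k))

  opaque
    unfolding _⊛_

    const-* : ∀ x y → const x * const y ≈ const (x R.* y)
    const-* x y = coeffwise λ where
      zero    → R.refl
      (suc n) → R.trans (const-⊛ x (const y) (suc n)) (R.zeroʳ x)

  opaque
    unfolding _⊕_

    head-tail : ∀ f → f ≈ const (f 0) + X * tail f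
    head-tail f = coeffwise λ where
      zero    → R.sym (R.trans (R.+-congˡ (X-⊛-zero (tail f))) (R.+-identityʳ _))
      (suc n) → R.sym (R.trans (R.+-congˡ (X-⊛-suc (tail f) n)) (R.+-identityˡ _))

  section-2-V : ∀ f → section 2 (V f) ≈ 0#
  section-2-V f = coeffwise (go f)
    where
    go : ∀ f n → V f (2 +ⁿ n *ⁿ 3) R.≈ R.0#
    go f zero    = R.refl
    go f (suc n) = go (tail f) n

  section-2-XV : ∀ f → section 2 (X * V f) ≈ 0#
  section-2-XV f = coeffwise λ n → R.trans (X-⊛-suc (V f) (1 +ⁿ n *ⁿ 3)) (go f n)
    where
    go : ∀ f n → V f (1 +ⁿ n *ⁿ 3) R.≈ R.0#
    go f zero    = R.refl
    go f (suc n) = go (tail f) n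

  section-2-cubic : ∀ {f g h} → f ≈ V g + X * h → Cubic h → section 2 f ≈ 0#
  section-2-cubic {f} {g} {h} p (h′ , r) = coeffwise λ n → R.trans (at (trans p (+-congˡ (*-congˡ r))) (2 +ⁿ n *ⁿ 3))
    (R.trans (⊕-coeff _ _ _) (R.trans (R.+-cong (at (section-2-V g) n) (at (section-2-XV h′) n)) (R.+-identityˡ _)))

  V-X^ : ∀ k → V (X ^ k) ≈ X ^ (3 *ⁿ k)
  V-X^ k = trans (V-^ X k) (trans (^-congˡ k V-X) (^-assocʳ X 3 k))

  V-neg : ∀ f → V (- f) ≈ - V f
  V-neg f = +-inverseˡ-unique _ _ (trans (sym (V-+ (- f) f)) (trans (V-cong (-‿inverseˡ f)) V-0))

  U²-periodic : ∀ {f} → U (U f) ≈ f → ∀ α m → f (3 ^ⁿ (2 *ⁿ α) *ⁿ m) R.≈ f m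
  U²-periodic {f} p zero    m = R.reflexive (≡.cong f (ℕ.*-identityˡ m))
  U²-periodic {f} p (suc α) m = R.trans (R.reflexive (≡.cong f index))
    (R.trans (U²-periodic p α (m *ⁿ 3 *ⁿ 3)) (at p m))
    where
    index : 3 ^ⁿ (2 *ⁿ suc α) *ⁿ m ≡ 3 ^ⁿ (2 *ⁿ α) *ⁿ (m *ⁿ 3 *ⁿ 3)
    index = ≡.trans (≡.cong (λ i → 3 ^ⁿ i *ⁿ m) (ℕ.*-suc 2 α))
      (let open NatSolver.+-*-Solver in
       solve 2 (λ x m → con 3 :* (con 3 :* x) :* m := x :* (m :* con 3 :* con 3)) ≡.refl (3 ^ⁿ (2 *ⁿ α)) m)

  -- The index is 27 · 9^α (3n + 2), since `suc α` encodes an exponent parameter at least 1. `U`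
  -- applied three times absorbs the 27, invariance of g under U² absorbs 9^α, and g has no term at
  -- 3n + 2.
  vanishes : ∀ {f g} → U (U (U f)) ≈ g → U (U g) ≈ g → section 2 g ≈ 0# →
             ∀ α n → f (3 ^ⁿ (2 *ⁿ suc α +ⁿ 1) *ⁿ (3 *ⁿ n +ⁿ 2)) R.≈ R.0#
  vanishes {f} {g} p r s α n = R.trans (R.reflexive (≡.cong f index))
    (R.trans (at p (3 ^ⁿ (2 *ⁿ α) *ⁿ (2 +ⁿ n *ⁿ 3))) (R.trans (U²-periodic r α (2 +ⁿ n *ⁿ 3)) (at s n)))
    where
    index : 3 ^ⁿ (2 *ⁿ suc α +ⁿ 1) *ⁿ (3 *ⁿ n +ⁿ 2) ≡ 3 ^ⁿ (2 *ⁿ α) *ⁿ (2 +ⁿ n *ⁿ 3) *ⁿ 3 *ⁿ 3 *ⁿ 3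
    index = ≡.trans (≡.cong (λ i → 3 ^ⁿ i *ⁿ (3 *ⁿ n +ⁿ 2))
                      (≡.trans (ℕ.+-comm (2 *ⁿ suc α) 1) (≡.cong suc (ℕ.*-suc 2 α))))
      (let open NatSolver.+-*-Solver in
       solve 2 (λ x n → con 3 :* (con 3 :* (con 3 :* x)) :* (con 3 :* n :+ con 2) :=
                        x :* (con 2 :+ n :* con 3) :* con 3 :* con 3 :* con 3) ≡.refl (3 ^ⁿ (2 *ⁿ α)) n)

-- The recurrence in the largest part for overpartition numbers

guard-+ : ∀ k a n x → guard (k +ⁿ a) (k +ⁿ n) x ≡ guard a n x
guard-+ zero    a n x = ≡.refl
guard-+ (suc k) a n x = guard-+ k a n x

guard-< : ∀ {a n} x → n < a → guard a n x ≡ 0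
guard-< {suc a} {zero}  x _         = ≡.refl
guard-< {suc a} {suc n} x (s≤s n<a) = guard-< x n<a

-- Remove one part m + 1: a single occurrence leaves an overpartition into parts at most m, still
-- counted twice for the overline, and j + 1 occurrences become j.
occ-shift : ∀ m n j → occ m (suc m +ⁿ n) (suc j) ≡ 2 *ⁿ opb m n +ⁿ occ m n j
occ-shift m n zero = begin
  guard (suc m +ⁿ 0) (suc m +ⁿ n) (2 *ⁿ opb m ((suc m +ⁿ n) ∸ (suc m +ⁿ 0)))
    ≡⟨ guard-+ (suc m) 0 n _ ⟩
  2 *ⁿ opb m ((suc m +ⁿ n) ∸ (suc m +ⁿ 0))
    ≡⟨ ≡.cong (λ i → 2 *ⁿ opb m i) ([m+n]∸[m+o]≡n∸o (suc m) n 0) ⟩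
  2 *ⁿ opb m n
    ≡⟨ ℕ.+-identityʳ _ ⟨
  2 *ⁿ opb m n +ⁿ 0 ∎
  where open ≡-Reasoning
occ-shift m n (suc j) = begin
  occ m (k +ⁿ n) (suc j) +ⁿ guard (k +ⁿ suc j *ⁿ k) (k +ⁿ n) (2 *ⁿ opb m ((k +ⁿ n) ∸ (k +ⁿ suc j *ⁿ k)))
    ≡⟨ ≡.cong₂ _+ⁿ_ (occ-shift m n j) (guard-+ k (suc j *ⁿ k) n _) ⟩
  2 *ⁿ opb m n +ⁿ occ m n j +ⁿ guard (suc j *ⁿ k) n (2 *ⁿ opb m ((k +ⁿ n) ∸ (k +ⁿ suc j *ⁿ k)))
    ≡⟨ ≡.cong (λ i → 2 *ⁿ opb m n +ⁿ occ m n j +ⁿ guard (suc j *ⁿ k) n (2 *ⁿ opb m i))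
         ([m+n]∸[m+o]≡n∸o k n (suc j *ⁿ k)) ⟩
  2 *ⁿ opb m n +ⁿ occ m n j +ⁿ guard (suc j *ⁿ k) n (2 *ⁿ opb m (n ∸ suc j *ⁿ k))
    ≡⟨ ℕ.+-assoc (2 *ⁿ opb m n) (occ m n j) _ ⟩
  2 *ⁿ opb m n +ⁿ occ m n (suc j) ∎
  where
  open ≡-Reasoning
  k = suc m

-- More than n occurrences of a positive part exceed n, so the further summands are cut off by
-- `guard`.
occ-saturate : ∀ m n j → occ m n (j +ⁿ n) ≡ occ m n n
occ-saturate m n zero    = ≡.refl
occ-saturate m n (suc j) =
  ≡.trans (≡.cong₂ _+ⁿ_ (occ-saturate m n j)
            (guard-< _ (ℕ.≤-trans (s≤s (ℕ.m≤n+m n j)) (ℕ.m≤m*n (suc j +ⁿ n) (suc m)))))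
          (ℕ.+-identityʳ _)

occ-< : ∀ m n j → n < suc m → occ m n j ≡ 0
occ-< m n zero    n<k = ≡.refl
occ-< m n (suc j) n<k =
  ≡.cong₂ _+ⁿ_ (occ-< m n j n<k) (guard-< _ (ℕ.≤-trans n<k (ℕ.m≤m+n (suc m) (j *ⁿ suc m))))

opb-step-< : ∀ m n → n < suc m → opb (suc m) n ≡ opb m n
opb-step-< m n n<k = ≡.trans (≡.cong (opb m n +ⁿ_) (occ-< m n n n<k)) (ℕ.+-identityʳ _)

-- The coefficient form of (1 - q^(m+1)) O(m+1) = (1 + q^(m+1)) O(m), written without subtraction.
opb-step-+ : ∀ m n → opb (suc m) (suc m +ⁿ n) ≡ opb m (suc m +ⁿ n) +ⁿ (opb (suc m) n +ⁿ opb m n)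
opb-step-+ m n = ≡.cong (opb m (suc m +ⁿ n) +ⁿ_) (begin
  occ m (suc m +ⁿ n) (suc m +ⁿ n)          ≡⟨ occ-shift m n (m +ⁿ n) ⟩
  2 *ⁿ opb m n +ⁿ occ m n (m +ⁿ n)         ≡⟨ ≡.cong (2 *ⁿ opb m n +ⁿ_) (occ-saturate m n m) ⟩
  2 *ⁿ opb m n +ⁿ occ m n n                ≡⟨ rearrange (opb m n) (occ m n n) ⟩
  opb m n +ⁿ occ m n n +ⁿ opb m n          ∎)
  where
  open ≡-Reasoning
  rearrange : ∀ x y → 2 *ⁿ x +ⁿ y ≡ x +ⁿ y +ⁿ x
  rearrange = let open NatSolver.+-*-Solver in
    solve 2 (λ x y → con 2 :* x :+ y := x :+ y :+ x) ≡.refl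

opb-stable : ∀ {n N} → n ≤′ N → opb N n ≡ pbar n
opb-stable ≤′-refl                = ≡.refl
opb-stable {n} (≤′-step {N} n≤N) = ≡.trans (opb-step-< N n (s≤s (ℕ.≤′⇒≤ n≤N))) (opb-stable n≤N)

-- Generating functions over an arbitrary coefficient ring

module Gauss {c ℓ} (R : CommutativeRing c ℓ) where

  private
    module R = CommutativeRing R
  open PowerSeries R
  open Trisection R
  open CommutativeRing series hiding (zero)
  open Exp semiring using (_^_; ^-congˡ; ^-congʳ; ^-assocʳ)
  open Mult semiring using () renaming (_×_ to _×′_)
  open CExp commutativeSemiring using (^-distrib-*)
  open RMult R.semiring using (×-homo-+; ×1-homo-*; ×-congˡ) renaming (_×_ to _×ᴿ_)
  open RingProperties ring using (-‿involutive)
  open import Relation.Binary.Reasoning.Setoid setoid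

  ι : (ℕ → ℕ) → Series
  ι a n = a n ×ᴿ R.1#

  O : ℕ → Series
  O m = ι (opb m)

  P : Series
  P = ι pbar

  ι-conv : ∀ a b → ι (conv a b) ≈ ι a * ι b
  ι-conv a b = coeffwise λ n →
    R.trans (×-congˡ (≡.cong sum (map-applyUpTo (λ i → i) (λ i → a i *ⁿ b (n ∸ i)) (suc n)))) (go a n)
    where
    opaque
      unfolding _⊛_

      -- Generalised over `a`: dropping the summand i = 0 shifts `a`, just as `_⊛_` passes to the
      -- tail of its first factor.
      go : ∀ a n → sum (applyUpTo (λ i → a i *ⁿ b (n ∸ i)) (suc n)) ×ᴿ R.1# R.≈ (ι a * ι b) n
      go a zero    = R.trans (×-congˡ (ℕ.+-identityʳ (a 0 *ⁿ b 0))) (×1-homo-* (a 0) (b 0))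
      go a (suc n) = R.trans (×-homo-+ R.1# (a 0 *ⁿ b (suc n)) _)
                             (R.+-cong (×1-homo-* (a 0) (b (suc n))) (go (λ i → a (suc i)) n))

  ι-pbar3 : ι pbar3 ≈ P ^ 3
  ι-pbar3 = trans (ι-conv pbar (conv pbar pbar)) (*-congˡ (trans (ι-conv pbar pbar) (*-congˡ (sym (*-identityʳ P)))))

  -- Congruence modulo q^(N+1), which takes the place of limits.
  Agree : ℕ → Series → Series → Set ℓ
  Agree N f g = ∀ {i} → i ≤ N → f i R.≈ g i

  agree-* : ∀ {N f f′ g g′} → Agree N f f′ → Agree N g g′ → Agree N (f * g) (f′ * g′)
  agree-* p r {i} i≤N = ⊛-cong-≤ i (λ j≤i → p (ℕ.≤-trans j≤i i≤N)) (λ j≤i → r (ℕ.≤-trans j≤i i≤N))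

  agree-^ : ∀ {N f f′} k → Agree N f f′ → Agree N (f ^ k) (f′ ^ k)
  agree-^ zero    p _ = R.refl
  agree-^ (suc k) p   = agree-* p (agree-^ k p)

  P-agree : ∀ N → Agree N P (O N)
  P-agree N i≤N = ×-congˡ (≡.sym (opb-stable (ℕ.≤⇒≤′ i≤N)))

  O-zero : O 0 ≈ 1#
  O-zero = coeffwise λ { zero → R.+-identityʳ _ ; (suc n) → R.refl }

  O-step : ∀ m → O (suc m) ≈ O m + X ^ suc m * (O (suc m) + O m)
  O-step m = coeffwise step
    where
    s : Series
    s = O (suc m) + O m
    low : ∀ {n} → n < suc m → O (suc m) n R.≈ (O m + X ^ suc m * s) n
    low {n} n<k = R.trans (×-congˡ (opb-step-< m n n<k))
      (R.sym (R.trans (⊕-coeff _ _ n) (R.trans (R.+-congˡ (X^-coeff-< s n<k)) (R.+-identityʳ _))))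
    high : ∀ n → O (suc m) (suc m +ⁿ n) R.≈ (O m + X ^ suc m * s) (suc m +ⁿ n)
    high n = R.trans (×-congˡ (opb-step-+ m n))
      (R.trans (×-homo-+ R.1# (opb m (suc m +ⁿ n)) _)
      (R.trans (R.+-congˡ (R.trans (×-homo-+ R.1# (opb (suc m) n) _)
                          (R.sym (R.trans (X^-coeff (suc m) s n) (⊕-coeff _ _ n)))))
      (R.sym (⊕-coeff _ _ (suc m +ⁿ n)))))
    step : ∀ n → O (suc m) n R.≈ (O m + X ^ suc m * s) n
    step n with n ℕ.<? suc m
    ... | yes n<k = low n<k
    ... | no  n≮k = ≡.subst (λ i → O (suc m) i R.≈ (O m + X ^ suc m * s) i)
                            (ℕ.m+[n∸m]≡n (ℕ.≮⇒≥ n≮k)) (high (n ∸ suc m))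

  -- Partial sums of θ and a finite form of Gauss's identity

  sign : ℕ → Series
  sign zero    = 1#
  sign (suc k) = - sign k

  sign-alternates : ∀ k → sign k + sign (suc k) ≈ 0#
  sign-alternates k = -‿inverseʳ (sign k)

  squares : ℕ → Series
  squares zero    = 0#
  squares (suc N) = squares N + sign (suc N) * X ^ (suc N *ⁿ suc N)

  -- The limit of the partial sums read off diagonally: `squares N` is settled at exponent n once N
  -- ≥ n, because the next term has exponent (N+1)² > n.
  σ : Series
  σ n = squares n n

  θₙ : ℕ → Series
  θₙ N = 1# + (squares N + squares N)

  θ : Series
  θ = 1# + (σ + σ)

  *X^-coeff-< : ∀ {k i} f → i < k → (f * X ^ k) i R.≈ R.0#
  *X^-coeff-< {k} {i} f i<k = R.trans (at (*-comm f (X ^ k)) i) (X^-coeff-< f i<k)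

  squares-stable : ∀ {n N} → n ≤′ N → squares N n R.≈ σ n
  squares-stable ≤′-refl = R.refl
  squares-stable {n} (≤′-step {N} n≤N) =
    R.trans (⊕-coeff _ _ n)
    (R.trans (R.+-cong (squares-stable n≤N)
      (*X^-coeff-< (sign (suc N)) (ℕ.≤-trans (s≤s (ℕ.≤′⇒≤ n≤N)) (ℕ.m≤m*n (suc N) (suc N)))))
    (R.+-identityʳ _))

  θ-agree : ∀ N → Agree N θ (θₙ N)
  θ-agree N {i} i≤N = R.trans (⊕-coeff _ _ i) (R.trans (R.+-congˡ (R.trans (⊕-coeff _ _ i)
      (R.trans (R.+-cong σᵢ σᵢ) (R.sym (⊕-coeff _ _ i))))) (R.sym (⊕-coeff _ _ i)))
    where
    σᵢ : σ i R.≈ squares N i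
    σᵢ = R.sym (squares-stable (ℕ.≤⇒≤′ i≤N))

  -- B k (q^(k+1)) is the product O k * θₙ k: the sum 1 + Σ_{s ≤ k} (-1)^s (O_s + O_{s-1}) z^s telescopes when
  -- (1 + z) B k z is compared with (1 - z) B k (q z), since q^s (O_s + O_{s-1}) = O_s - O_{s-1}.
  B : ℕ → Series → Series
  B zero    z = 1#
  B (suc k) z = B k z + sign (suc k) * (O (suc k) + O k) * z ^ suc k

  B-telescope : ∀ k z → B k (X * z) ≈ (1# + z) * B k z + z * B k (X * z) + (z + z) * sign (suc k) * O k * z ^ k
  B-telescope zero z = trans (Identities.telescope-base series z (sign-alternates 0))
    (+-congˡ (sym (trans (*-identityʳ _) (trans (*-congˡ O-zero) (*-identityʳ _)))))
  B-telescope (suc k) z = begin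
    B k (X * z) + e * w * (X * z) ^ suc k
      ≈⟨ split ⟩
    B k (X * z) + e * w * (X ^ suc k * z ^ suc k)
      ≈⟨ Identities.telescope-step series (B-telescope k z) (sign-alternates (suc k)) (O-step k) ⟩
    (1# + z) * B (suc k) z + z * (B k (X * z) + e * w * (X ^ suc k * z ^ suc k)) + (z + z) * sign (suc (suc k)) * O (suc k) * z ^ suc k
      ≈⟨ +-congʳ (+-congˡ (*-congˡ split)) ⟨
    (1# + z) * B (suc k) z + z * B (suc k) (X * z) + (z + z) * sign (suc (suc k)) * O (suc k) * z ^ suc k ∎
    where
    e w : Series
    e = sign (suc k)
    w = O (suc k) + O k
    split : B (suc k) (X * z) ≈ B k (X * z) + e * w * (X ^ suc k * z ^ suc k)
    split = +-congˡ (*-congˡ (^-distrib-* X z (suc k)))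

  -- The hypothesis says (1 - q^(k+1)) (f - g) = 0. The shifted terms at exponent n involve
  -- coefficients below n only, so equality follows by strong induction on n.
  cancel-1-X^ : ∀ k {f g} → f + X ^ suc k * g ≈ g + X ^ suc k * f → f ≈ g
  cancel-1-X^ k {f} {g} p = coeffwise λ n → go n (ℕ.<-wellFounded n)
    where
    open RingProperties R.ring using () renaming (+-cancelʳ to R-cancelʳ)
    expand : ∀ n → f n R.+ (X ^ suc k * g) n R.≈ g n R.+ (X ^ suc k * f) n
    expand n = R.trans (R.sym (⊕-coeff _ _ n)) (R.trans (at p n) (⊕-coeff _ _ n))
    same : ∀ n → Acc _<_ n → (X ^ suc k * g) n R.≈ (X ^ suc k * f) n
    go : ∀ n → Acc _<_ n → f n R.≈ g n
    go n r = R-cancelʳ _ _ _ (R.trans (expand n) (R.+-congˡ (R.sym (same n r))))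
    same n (acc rec) with n ℕ.<? suc k
    ... | yes n<k = R.trans (X^-coeff-< g n<k) (R.sym (X^-coeff-< f n<k))
    ... | no  n≮k = ≡.subst (λ i → (X ^ suc k * g) i R.≈ (X ^ suc k * f) i) k+j≡n
                      (R.trans (X^-coeff (suc k) g j)
                      (R.trans (R.sym (go j (rec (≡.subst (j <_) k+j≡n (s≤s (ℕ.m≤n+m j k))))))
                               (R.sym (X^-coeff (suc k) f j))))
      where
      j = n ∸ suc k
      k+j≡n = ℕ.m+[n∸m]≡n (ℕ.≮⇒≥ n≮k)

  -- Induction with z = q^(n+1). The telescoped relation at z leads from B (n+1) (q z) back to B
  -- (n+1) z, whose part B n z is known by induction; its last summand and the boundary term account
  -- for the new term of θ, as z^(n+1) = q^((n+1)²). The common factor 1 - z is then cancelled.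
  Oθₙ≈B : ∀ n → O n * θₙ n ≈ B n (X ^ suc n)
  Oθₙ≈B zero    = trans (*-cong O-zero (trans (+-congˡ (+-identityʳ _)) (+-identityʳ _))) (*-identityʳ _)
  Oθₙ≈B (suc n) = cancel-1-X^ n (trans (+-congʳ unfold)
    (trans (Identities.telescope-close series (B-telescope (suc n) z) (sign-alternates (suc n)) (O-step n) (Oθₙ≈B n))
           (+-congˡ (*-congˡ (sym unfold)))))
    where
    z t : Series
    z = X ^ suc n
    t = sign (suc n) * z ^ suc n
    unfold : O (suc n) * θₙ (suc n) ≈ O (suc n) * (θₙ n + (t + t))
    unfold = *-congˡ (trans
      (+-congˡ (+-cong (+-congˡ (*-congˡ (sym (^-assocʳ X (suc n) (suc n)))))
                        (+-congˡ (*-congˡ (sym (^-assocʳ X (suc n) (suc n)))))))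
      (Identities.double-+ series 1# (squares n) t))

  -- Every summand after the 1 carries a positive power of q^(n+1).
  B-agree-1 : ∀ k n → Agree n (B k (X ^ suc n)) 1#
  B-agree-1 zero    n _ = R.refl
  B-agree-1 (suc k) n {i} i≤n =
    R.trans (⊕-coeff _ _ i) (R.trans (R.+-cong (B-agree-1 k n i≤n)
      (R.trans (at (Identities.move-factor series _ _ _) i) (X^-coeff-< _ (s≤s i≤n)))) (R.+-identityʳ _))

  gauss : P * θ ≈ 1#
  gauss = coeffwise λ n →
    R.trans (agree-* (P-agree n) (θ-agree n) ℕ.≤-refl) (R.trans (at (Oθₙ≈B n) n) (B-agree-1 n n ℕ.≤-refl))

  -- Trisection of θ

  V-sign : ∀ k → V (sign k) ≈ sign k
  V-sign zero    = V-const R.1#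
  V-sign (suc k) = trans (V-neg (sign k)) (-‿cong (V-sign k))

  sign-*3 : ∀ k → sign (k *ⁿ 3) ≈ sign k
  sign-*3 zero    = refl
  sign-*3 (suc k) = -‿cong (trans (-‿involutive _) (sign-*3 k))

  -- (3N+1)² and (3N+2)² are 1 modulo 3 and go into b. The remaining squares (3N+3)² = 9 (N+1)² keep
  -- the sign of N + 1, as 3 is odd, so they reproduce the partial sum at q⁹.
  trisect-squares : ∀ N → ∃ λ b → squares (N *ⁿ 3) ≈ V (V (squares N)) + X * V b
  trisect-squares zero = 0# , sym (trans (+-cong (trans (V-cong V-0) V-0) (trans (*-congˡ V-0) (zeroʳ X))) (+-identityʳ 0#))
  trisect-squares (suc N) with trisect-squares N
  ... | b , p = b + (s₁ * X ^ m₁ + s₂ * X ^ m₂) , (begin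
      squares M + s₁ * X ^ (suc M *ⁿ suc M) + s₂ * X ^ (suc (suc M) *ⁿ suc (suc M))
        + sign (suc N *ⁿ 3) * X ^ ((3 +ⁿ M) *ⁿ (3 +ⁿ M))
        ≈⟨ +-cong (+-cong (+-cong p (*-congˡ X₁)) (*-congˡ X₂)) (*-cong (sign-*3 (suc N)) X₃) ⟩
      V (V (squares N)) + X * V b + s₁ * (X * V (X ^ m₁)) + s₂ * (X * V (X ^ m₂)) + sign (suc N) * V (V q)
        ≈⟨ Identities.trisect-regroup series _ _ _ _ _ _ _ _ ⟩
      V (V (squares N)) + sign (suc N) * V (V q) + X * (V b + (s₁ * V (X ^ m₁) + s₂ * V (X ^ m₂)))
        ≈⟨ +-cong V-squares (*-congˡ V-b) ⟨
      V (V (squares (suc N))) + X * V (b + (s₁ * X ^ m₁ + s₂ * X ^ m₂)) ∎)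
    where
    M m₁ m₂ m₃ : ℕ
    M  = N *ⁿ 3
    m₁ = 3 *ⁿ N *ⁿ N +ⁿ 2 *ⁿ N
    m₂ = 3 *ⁿ N *ⁿ N +ⁿ 4 *ⁿ N +ⁿ 1
    m₃ = suc N *ⁿ suc N
    s₁ s₂ q : Series
    s₁ = sign (1 +ⁿ M)
    s₂ = sign (2 +ⁿ M)
    q  = X ^ m₃
    open NatSolver.+-*-Solver
    X₁ : X ^ (suc M *ⁿ suc M) ≈ X * V (X ^ m₁)
    X₁ = trans (^-congʳ X (solve 1 (λ N → (con 1 :+ N :* con 3) :* (con 1 :+ N :* con 3) :=
                  con 1 :+ con 3 :* (con 3 :* N :* N :+ con 2 :* N)) ≡.refl N)) (*-congˡ (sym (V-X^ m₁)))
    X₂ : X ^ (suc (suc M) *ⁿ suc (suc M)) ≈ X * V (X ^ m₂)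
    X₂ = trans (^-congʳ X (solve 1 (λ N → (con 2 :+ N :* con 3) :* (con 2 :+ N :* con 3) :=
                  con 1 :+ con 3 :* (con 3 :* N :* N :+ con 4 :* N :+ con 1)) ≡.refl N)) (*-congˡ (sym (V-X^ m₂)))
    X₃ : X ^ ((3 +ⁿ M) *ⁿ (3 +ⁿ M)) ≈ V (V q)
    X₃ = trans (^-congʳ X (solve 1 (λ N → (con 3 :+ N :* con 3) :* (con 3 :+ N :* con 3) :=
                  con 3 :* (con 3 :* ((con 1 :+ N) :* (con 1 :+ N)))) ≡.refl N))
               (sym (trans (V-cong (V-X^ m₃)) (V-X^ (3 *ⁿ m₃))))
    V-squares : V (V (squares (suc N))) ≈ V (V (squares N)) + sign (suc N) * V (V q)
    V-squares = trans (V-cong (trans (V-+ _ _) (+-congˡ (trans (V-* _ _) (*-congʳ (V-sign (suc N)))))))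
                (trans (V-+ _ _) (+-congˡ (trans (V-* _ _) (*-congʳ (V-sign (suc N))))))
    V-term : ∀ k m → V (sign k * X ^ m) ≈ sign k * V (X ^ m)
    V-term k m = trans (V-* _ _) (*-congʳ (V-sign k))
    V-b : V (b + (s₁ * X ^ m₁ + s₂ * X ^ m₂)) ≈ V b + (s₁ * V (X ^ m₁) + s₂ * V (X ^ m₂))
    V-b = trans (V-+ _ _) (+-congˡ (trans (V-+ _ _) (+-cong (V-term (1 +ⁿ M) m₁) (V-term (2 +ⁿ M) m₂))))

  trisect-θₙ : ∀ N → ∃ λ b → θₙ (N *ⁿ 3) ≈ V (V (θₙ N)) + X * V b
  trisect-θₙ N with trisect-squares N
  ... | b , p = b + b , (begin
    1# + (squares (N *ⁿ 3) + squares (N *ⁿ 3))           ≈⟨ +-congˡ (+-cong p p) ⟩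
    1# + ((v + X * V b) + (v + X * V b))                 ≈⟨ Identities.double-trisect series v X (V b) ⟩
    1# + (v + v) + X * (V b + V b)                       ≈⟨ +-cong V-θ (*-congˡ (V-+ b b)) ⟨
    V (V (θₙ N)) + X * V (b + b)                         ∎)
    where
    v : Series
    v = V (V (squares N))
    V-1+2 : ∀ f → V (1# + (f + f)) ≈ 1# + (V f + V f)
    V-1+2 f = trans (V-+ _ _) (+-cong (V-const R.1#) (V-+ f f))
    V-θ : V (V (θₙ N)) ≈ 1# + (v + v)
    V-θ = trans (V-cong (V-1+2 (squares N))) (V-1+2 (V (squares N)))

  V-agree : ∀ {N f g} → Agree N f g → Agree N (V f) (V g)
  V-agree p {i} i≤N = V-coeff-cong _ _ i (λ j≤i → p (ℕ.≤-trans j≤i i≤N))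

  U-θ : U θ ≈ V θ
  U-θ = coeffwise λ n → R.trans (θ-agree (n *ⁿ 3) ℕ.≤-refl)
    (R.trans (at (U-cubic (expand n) (cubic-V _) (cubic-V 0#)) n) (R.sym (V-agree (θ-agree n) ℕ.≤-refl)))
    where
    expand : ∀ n → θₙ (n *ⁿ 3) ≈ V (V (θₙ n)) + X * V (proj₁ (trisect-θₙ n)) + X * (X * V 0#)
    expand n = trans (proj₂ (trisect-θₙ n))
      (sym (trans (+-congˡ (trans (*-congˡ (trans (*-congˡ V-0) (zeroʳ X))) (zeroʳ X))) (+-identityʳ _)))

  section-2-θ : section 2 θ ≈ 0#
  -- Exponent 2 + 3n lies beyond 3n, hence the truncation at 3 (n + 1).
  section-2-θ = coeffwise λ n → R.trans (θ-agree (suc n *ⁿ 3) (ℕ.n≤1+n _))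
    (at (section-2-cubic (proj₂ (trisect-θₙ (suc n))) (cubic-V _)) n)

  trisect-θ : θ ≈ V (V θ) + X * V (section 1 θ)
  trisect-θ = trans (trisect θ) (trans
    (+-cong (+-congʳ (V-cong U-θ)) (trans (*-congˡ (trans (*-congˡ (trans (V-cong section-2-θ) V-0)) (zeroʳ X))) (zeroʳ X)))
    (+-identityʳ _))

  U-θ² : U (θ ^ 2) ≈ V θ ^ 2
  U-θ² = U-cubic {h = 2 ×′ 1# * (V (V θ) * V b)} {k = V b * V b}
      (trans (^-congˡ 2 trisect-θ) (trans (Identities.square-expand series _ _ _) (+-congʳ (+-congʳ (sym (V-^ (V θ) 2))))))
      (cubic-* (cubic-ℕ 2) (cubic-* (cubic-V _) (cubic-V _))) (cubic-* (cubic-V _) (cubic-V _))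
    where
    b : Series
    b = section 1 θ

  -- A factor in q³ does not move exponents between residue classes modulo 3, and θ has none in the
  -- class of 2.
  section-2-V*θ : ∀ f → section 2 (V f * θ) ≈ 0#
  section-2-V*θ f = section-2-cubic {g = f * V θ} {h = V f * V (section 1 θ)}
    (trans (*-congˡ trisect-θ) (trans (distribˡ _ _ _)
      (+-cong (sym (V-* _ _)) (Identities.move-factor series _ _ _))))
    (cubic-* (cubic-V _) (cubic-V _))

-- Congruences modulo 9

module _ {c ℓ} (R : CommutativeRing c ℓ) where
  open CommutativeRing R
  open Mult semiring using (_×_)

  Annihilates : ℕ → Set (c ⊔ ℓ)
  Annihilates k = ∀ x → k × x ≈ 0#

  -- The quotient (x³ - x) / 3 is asked for as a witness, since 3 is a zero divisor in the intended
  -- ring.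
  FermatCube : Set (c ⊔ ℓ)
  FermatCube = ∀ x → ∃ λ y → x * (x * x) ≈ x + 3 × y

module ModNine {c ℓ} (R : CommutativeRing c ℓ) (9≈0 : Annihilates R 9) (fermat : FermatCube R) where

  private
    module R = CommutativeRing R
  open PowerSeries R
  open Trisection R
  open Gauss R
  open CommutativeRing series hiding (zero)
  open Exp semiring using (_^_; ^-congˡ; ^-congʳ; ^-assocʳ)
  open RingProperties ring using (-1*x≈-x; -‿involutive)
  open Mult semiring using (×-congʳ) renaming (_×_ to _×′_)
  open import Relation.Binary.Reasoning.Setoid setoid

  opaque
    unfolding _⊕_

    9*≈0 : ∀ f → 9 ×′ 1# * f ≈ 0#
    9*≈0 f = trans (*-congʳ (coeffwise λ n → 9≈0 (const R.1# n))) (zeroˡ f)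

  cubeTerms : Series → Series
  cubeTerms f = const (proj₁ (fermat (f 0))) + (a * a * (X * b) + a * (X * b) * (X * b))
    where
    a b : Series
    a = const (f 0)
    b = tail f

  -- The quotient (f³ - V f) / 3. With f = a + X b one has f³ - V f = 3 `cubeTerms f` + X³ (b³ - V
  -- b), so the same quotient for the tail enters three exponents later.
  cubeRemainder : Series → Series
  cubeRemainder f 0 = cubeTerms f 0
  cubeRemainder f 1 = cubeTerms f 1
  cubeRemainder f 2 = cubeTerms f 2
  cubeRemainder f (suc (suc (suc n))) = cubeTerms f (3 +ⁿ n) R.+ cubeRemainder (tail f) n

  opaque
    unfolding _⊕_

    cubeRemainder-step : ∀ f → cubeRemainder f ≈ cubeTerms f + X ^ 3 * cubeRemainder (tail f)
    cubeRemainder-step f = coeffwise λ where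
        0 → low 0 (s≤s z≤n)
        1 → low 1 (s≤s (s≤s z≤n))
        2 → low 2 (s≤s (s≤s (s≤s z≤n)))
        (suc (suc (suc n))) → R.+-congˡ (R.sym (X^-coeff 3 (cubeRemainder (tail f)) n))
      where
      low : ∀ i → i < 3 → cubeTerms f i R.≈ cubeTerms f i R.+ (X ^ 3 * cubeRemainder (tail f)) i
      low i i<3 = R.sym (R.trans (R.+-congˡ (X^-coeff-< (cubeRemainder (tail f)) i<3)) (R.+-identityʳ _))

  opaque
    unfolding _⊕_

    -- Both sides satisfy the same recursion, a common `base` plus X³ times the same expression for
    -- the tail. Thus coefficient n + 3 for f reduces to coefficient n for `tail f`.
    frobenius : ∀ f → f ^ 3 ≈ V f + 3 ×′ cubeRemainder f
    frobenius f = coeffwise (go f)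
      where
      base : Series → Series
      base f = const (f 0) + 3 ×′ cubeTerms f

      cube-step : ∀ f → f ^ 3 ≈ base f + X ^ 3 * (tail f ^ 3)
      cube-step f = begin
        f ^ 3
          ≈⟨ ^-congˡ 3 (head-tail f) ⟩
        (a + X * b) ^ 3
          ≈⟨ Identities.cube-expand series a b X ⟩
        a * (a * a) + 3 ×′ (a * a * (X * b) + a * (X * b) * (X * b)) + X ^ 3 * b ^ 3
          ≈⟨ +-congʳ (+-congʳ a³) ⟩
        a + 3 ×′ const (proj₁ (fermat (f 0))) + 3 ×′ (a * a * (X * b) + a * (X * b) * (X * b)) + X ^ 3 * b ^ 3
          ≈⟨ Identities.×3-collect series a _ _ _ ⟩
        base f + X ^ 3 * b ^ 3 ∎
        where
        a b : Series
        a = const (f 0)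
        b = tail f
        a³ : a * (a * a) ≈ a + 3 ×′ const (proj₁ (fermat (f 0)))
        a³ = begin
          a * (a * a)                                             ≈⟨ *-congˡ (const-* _ _) ⟩
          a * const (f 0 R.* f 0)                                 ≈⟨ const-* _ _ ⟩
          const (f 0 R.* (f 0 R.* f 0))                           ≈⟨ coeffwise coeffs ⟩
          a + 3 ×′ const (proj₁ (fermat (f 0)))                   ∎
          where
          coeffs : ∀ n → const (f 0 R.* (f 0 R.* f 0)) n R.≈ (a + 3 ×′ const (proj₁ (fermat (f 0)))) n
          coeffs zero    = proj₂ (fermat (f 0))
          coeffs (suc n) =
            R.sym (R.trans (R.+-identityˡ _) (R.trans (R.+-identityʳ _) (R.+-identityˡ _)))

      rhs-step : ∀ f → V f + 3 ×′ cubeRemainder f ≈ base f + X ^ 3 * (V (tail f) + 3 ×′ cubeRemainder (tail f))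
      rhs-step f = begin
        V f + 3 ×′ cubeRemainder f
          ≈⟨ +-cong (trans (V-cong (head-tail f)) (trans (V-+ _ _) (+-cong (V-const _) (trans (V-* _ _) (*-congʳ V-X)))))
                    (×-congʳ 3 (cubeRemainder-step f)) ⟩
        const (f 0) + X ^ 3 * V (tail f) + 3 ×′ (cubeTerms f + X ^ 3 * cubeRemainder (tail f))
          ≈⟨ Identities.×3-factor series _ _ _ _ _ ⟩
        base f + X ^ 3 * (V (tail f) + 3 ×′ cubeRemainder (tail f)) ∎

      go : ∀ f n → (f ^ 3) n R.≈ (V f + 3 ×′ cubeRemainder f) n
      go f n = R.trans (at (cube-step f) n) (R.trans (R.+-congˡ (rest n)) (R.sym (at (rhs-step f) n)))
        where
        low : ∀ {i} → i < 3 → ∀ g h → (X ^ 3 * g) i R.≈ (X ^ 3 * h) i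
        low i<3 g h = R.trans (X^-coeff-< g i<3) (R.sym (X^-coeff-< h i<3))
        g h : Series
        g = tail f ^ 3
        h = V (tail f) + 3 ×′ cubeRemainder (tail f)
        rest : ∀ n → (X ^ 3 * g) n R.≈ (X ^ 3 * h) n
        rest 0 = low (s≤s z≤n) g h
        rest 1 = low (s≤s (s≤s z≤n)) g h
        rest 2 = low (s≤s (s≤s (s≤s z≤n))) g h
        rest (suc (suc (suc n))) = R.trans (X^-coeff 3 g n) (R.trans (go (tail f) n) (R.sym (X^-coeff 3 h n)))

  -- Cubing lifts a congruence modulo 3 to one modulo 9.
  ninth-power : ∀ f → f ^ 9 ≈ V f ^ 3
  ninth-power f = begin
    f ^ 9
      ≈⟨ Identities.ninth-power-cubed series f ⟩
    (f ^ 3) ^ 3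
      ≈⟨ ^-congˡ 3 (frobenius f) ⟩
    (V f + 3 ×′ k) ^ 3
      ≈⟨ Identities.cube-of-[v+3k] series (V f) k ⟩
    V f ^ 3 + 9 ×′ 1# * (V f ^ 2 * k + 3 ×′ 1# * V f * k ^ 2 + 3 ×′ 1# * k ^ 3)
      ≈⟨ trans (+-congˡ (9*≈0 _)) (+-identityʳ _) ⟩
    V f ^ 3 ∎
    where
    k = cubeRemainder f

  M : Series → Series
  M f = U (f ^ 3)

  -- f³ differs from the series V f in q³ by a multiple of 3; hence everything in f³ outside
  -- exponents divisible by 3 is a multiple of 3.
  M-split : ∀ f → ∃ λ h → ∃ λ k → f ^ 3 ≈ V (M f) + 3 ×′ (X * V h + X * (X * V k))
  M-split f = section 1 r , section 2 r , (begin
      f ^ 3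
        ≈⟨ frobenius f ⟩
      V f + 3 ×′ r
        ≈⟨ +-congˡ (×-congʳ 3 (trisect r)) ⟩
      V f + 3 ×′ (V (U r) + X * V (section 1 r) + X * (X * V (section 2 r)))
        ≈⟨ Identities.×3-regroup series _ _ _ _ ⟩
      V f + 3 ×′ V (U r) + 3 ×′ (X * V (section 1 r) + X * (X * V (section 2 r)))
        ≈⟨ +-congʳ V-part ⟨
      V (M f) + 3 ×′ (X * V (section 1 r) + X * (X * V (section 2 r))) ∎)
    where
    r = cubeRemainder f
    V-part : V (M f) ≈ V f + 3 ×′ V (U r)
    V-part = begin
      V (M f)                    ≈⟨ V-cong (trans (U-cong (frobenius f)) (trans (U-+ _ _)
                                      (+-congˡ (trans (U-+ _ _) (+-congʳ (U-+ _ _)))))) ⟩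
      V (U (V f) + 3 ×′ U r)     ≈⟨ V-+ _ _ ⟩
      V (U (V f)) + V (3 ×′ U r) ≈⟨ +-cong (V-cong (U-V f)) (trans (V-+ _ _) (+-congʳ (V-+ _ _))) ⟩
      V f + 3 ×′ V (U r)         ∎

  -- The non-cubic parts of f³ and g³ are divisible by 3, so modulo 9 their product does not contribute.
  M-* : ∀ f g → M (f * g) ≈ M f * M g
  M-* f g with M-split f | M-split g
  ... | h₁ , k₁ , p | h₂ , k₂ , r = U-cubic expand
      (cubic-* (cubic-ℕ 3) (cubic-+ (cubic-* (cubic-V _) (cubic-V _)) (cubic-* (cubic-V _) (cubic-V _))))
      (cubic-* (cubic-ℕ 3) (cubic-+ (cubic-* (cubic-V _) (cubic-V _)) (cubic-* (cubic-V _) (cubic-V _))))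
    where
    a = V (M f)
    b = V (M g)
    expand : (f * g) ^ 3 ≈ V (M f * M g) + X * (3 ×′ 1# * (a * V h₂ + b * V h₁))
                                         + X * (X * (3 ×′ 1# * (a * V k₂ + b * V k₁)))
    expand = begin
      (f * g) ^ 3
        ≈⟨ Identities.cube-* series f g ⟩
      f ^ 3 * g ^ 3
        ≈⟨ *-cong p r ⟩
      (a + 3 ×′ (X * V h₁ + X * (X * V k₁))) * (b + 3 ×′ (X * V h₂ + X * (X * V k₂)))
        ≈⟨ Identities.[a+3s][b+3t] series a b X _ _ _ _ ⟩
      a * b + X * (3 ×′ 1# * (a * V h₂ + b * V h₁)) + X * (X * (3 ×′ 1# * (a * V k₂ + b * V k₁)))
        + 9 ×′ 1# * ((X * V h₁ + X * (X * V k₁)) * (X * V h₂ + X * (X * V k₂)))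
        ≈⟨ trans (+-congˡ (9*≈0 _)) (+-identityʳ _) ⟩
      a * b + X * (3 ×′ 1# * (a * V h₂ + b * V h₁)) + X * (X * (3 ×′ 1# * (a * V k₂ + b * V k₁)))
        ≈⟨ +-congʳ (+-congʳ (V-* _ _)) ⟨
      V (M f * M g) + X * (3 ×′ 1# * (a * V h₂ + b * V h₁)) + X * (X * (3 ×′ 1# * (a * V k₂ + b * V k₁))) ∎

  M-cong : ∀ {f g} → f ≈ g → M f ≈ M g
  M-cong p = U-cong (^-congˡ 3 p)

  M-V : ∀ f → M (V f) ≈ f ^ 3
  M-V f = trans (U-cong (sym (V-^ f 3))) (U-V (f ^ 3))

  M-1 : M 1# ≈ 1#
  M-1 = trans (M-cong (sym (V-const R.1#))) (trans (M-V 1#) (trans (*-identityˡ _) (trans (*-identityˡ _) (*-identityˡ _))))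

  -- What is common to 1 and -1, so that numerators 1 + q^k and denominators 1 - q^k of the product
  -- for P are handled at once.
  record Sign (e : Series) : Set ℓ where
    field
      square : e * e ≈ 1#
      fixed  : V e ≈ e

    cubic : Cubic e
    cubic = e , sym fixed

    cube : e * e * e ≈ e
    cube = trans (*-congʳ square) (*-identityˡ e)

  sign+ : Sign 1#
  sign+ = record { square = *-identityˡ 1# ; fixed = V-const R.1# }

  sign- : Sign (- 1#)
  sign- = record
    { square = trans (-1*x≈-x (- 1#)) (-‿involutive 1#)
    ; fixed  = trans (V-neg 1#) (-‿cong (V-const R.1#))
    }

  binomial : Series → ℕ → Series
  binomial e k = 1# + e * X ^ k

  V-binomial : ∀ {e} → Sign e → ∀ k → V (binomial e k) ≈ 1# + e * V (X ^ k)
  V-binomial s k = trans (V-+ _ _) (+-cong (V-const R.1#) (trans (V-* _ _) (*-congʳ (Sign.fixed s))))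

  V-binomial-*3 : ∀ {e} → Sign e → ∀ k → V (binomial e k) ≈ binomial e (k *ⁿ 3)
  V-binomial-*3 s k = trans (V-binomial s k) (+-congˡ (*-congˡ (trans (V-X^ k) (^-congʳ X (ℕ.*-comm 3 k)))))

  binomial-cubed : ∀ {e} → Sign e → ∀ k → 1# + e * e * e * (X ^ k) ^ 3 ≈ V (binomial e k)
  binomial-cubed s k = sym (trans (V-binomial s k) (+-congˡ (*-cong (sym (Sign.cube s))
    (trans (V-X^ k) (trans (^-congʳ X (ℕ.*-comm 3 k)) (sym (^-assocʳ X k 3)))))))

  -- In 1 + 3 e q^k + 3 e² q^(2k) + e³ q^(3k) with k prime to 3, only the outer terms have exponents
  -- divisible by 3, and e³ = e.
  M-binomial-1 : ∀ {e} → Sign e → ∀ i → M (binomial e (1 +ⁿ i *ⁿ 3)) ≈ binomial e (1 +ⁿ i *ⁿ 3)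
  M-binomial-1 {e} s i = U-cubic
      (trans (Identities.cube-binomial₁ series e X w) (+-congʳ (+-congʳ (binomial-cubed s (1 +ⁿ i *ⁿ 3)))))
      (cubic-* (cubic-ℕ 3) (cubic-* (Sign.cubic s) cubic-w))
      (cubic-* (cubic-ℕ 3) (cubic-* (cubic-* (Sign.cubic s) (Sign.cubic s)) (cubic-* cubic-w cubic-w)))
    where
    w : Series
    w = X ^ (i *ⁿ 3)
    cubic-w : Cubic w
    cubic-w = X ^ i , trans (^-congʳ X (ℕ.*-comm i 3)) (sym (V-X^ i))

  M-binomial-2 : ∀ {e} → Sign e → ∀ i → M (binomial e (2 +ⁿ i *ⁿ 3)) ≈ binomial e (2 +ⁿ i *ⁿ 3)
  M-binomial-2 {e} s i = U-cubic
      (trans (Identities.cube-binomial₂ series e X w) (+-congʳ (+-congʳ (binomial-cubed s (2 +ⁿ i *ⁿ 3)))))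
      (cubic-* (cubic-ℕ 3) (cubic-* (cubic-* (Sign.cubic s) (Sign.cubic s)) (cubic-* cubic-X³ (cubic-* cubic-w cubic-w))))
      (cubic-* (cubic-ℕ 3) (cubic-* (Sign.cubic s) cubic-w))
    where
    w : Series
    w = X ^ (i *ⁿ 3)
    cubic-w : Cubic w
    cubic-w = X ^ i , trans (^-congʳ X (ℕ.*-comm i 3)) (sym (V-X^ i))

  -- Here the binomial is itself `V` of a binomial, and `U` undoes `V` on the cube.
  M-binomial-3 : ∀ {e} → Sign e → ∀ i → M (binomial e (i *ⁿ 3)) ≈ binomial e i ^ 3
  M-binomial-3 s i = trans (M-cong (sym (V-binomial-*3 s i))) (M-V (binomial _ i))

  O-ratio : ∀ m → binomial (- 1#) (suc m) * O (suc m) ≈ binomial 1# (suc m) * O m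
  O-ratio m = Identities.ratio series (-‿inverseʳ 1#) (O-step m)

  ratio-map : ∀ (F : Series → Series) → (∀ {f g} → f ≈ g → F f ≈ F g) → (∀ f g → F (f * g) ≈ F f * F g) →
              ∀ {d n d′ n′ f g} → F d ≈ d′ → F n ≈ n′ → d * f ≈ n * g → d′ * F f ≈ n′ * F g
  ratio-map F F-cong F-* {d} {n} {d′} {n′} {f} {g} p r h = begin
    d′ * F f    ≈⟨ *-congʳ p ⟨
    F d * F f   ≈⟨ F-* d f ⟨
    F (d * f)   ≈⟨ F-cong h ⟩
    F (n * g)   ≈⟨ F-* n g ⟩
    F n * F g   ≈⟨ *-congʳ r ⟩
    n′ * F g    ∎

  cancel-binomial : ∀ k {f g} → binomial (- 1#) (suc k) * f ≈ binomial (- 1#) (suc k) * g → f ≈ g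
  cancel-binomial k p = cancel-1-X^ k (Identities.unratio series (-‿inverseʳ 1#) p)

  -- From j to j + 1, `O (j *ⁿ 3)` gains the factors at 3j+1, 3j+2, 3j+3 and `O j` the one at j+1.
  -- On the left, `M` keeps the first two and turns the third into the cube of the factor at j+1,
  -- while `V` turns the factor at j+1 into the one at 3j+3. On the right the same factors appear
  -- directly. The denominators, which have constant term 1, are cancelled one by one.
  M-O : ∀ j → M (O (j *ⁿ 3)) * V (O j) ≈ O (j *ⁿ 3) * O j ^ 3
  M-O zero = begin
    M (O 0) * V (O 0)  ≈⟨ *-cong (trans (M-cong O-zero) M-1) (trans (V-cong O-zero) (V-const R.1#)) ⟩
    1# * 1#            ≈⟨ *-congˡ (trans (*-identityˡ _) (trans (*-identityˡ _) (*-identityˡ _))) ⟨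
    1# * 1# ^ 3        ≈⟨ *-cong O-zero (^-congˡ 3 O-zero) ⟨
    O 0 * O 0 ^ 3      ∎
  M-O (suc j) = cancel-binomial k (cancel-binomial (suc k) (cancel-cube (cancel-binomial (suc (suc k)) (begin
      d₃ * (d′ ^ 3 * (d₂ * (d₁ * (M (O (3 +ⁿ k)) * V (O (suc j))))))
        ≈⟨ gather d₃ (d′ ^ 3) d₂ d₁ _ ⟩
      d₁ * (d₂ * (d′ ^ 3 * d₃)) * (M (O (3 +ⁿ k)) * V (O (suc j)))
        ≈⟨ Identities.ratio-chain series
             (ratio-M (M-binomial-1 sign- j) (M-binomial-1 sign+ j) (O-ratio k))
             (ratio-M (M-binomial-2 sign- j) (M-binomial-2 sign+ j) (O-ratio (suc k)))
             (ratio-M (M-binomial-3 sign- (suc j)) (M-binomial-3 sign+ (suc j)) (O-ratio (suc (suc k))))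
             (ratio-map V V-cong V-* (V-binomial-*3 sign- (suc j)) (V-binomial-*3 sign+ (suc j)) (O-ratio j)) ⟩
      n₁ * (n₂ * (n′ ^ 3 * n₃)) * (M (O k) * V (O j))
        ≈⟨ *-cong (*-congˡ (*-congˡ (*-comm _ _))) (M-O j) ⟩
      n₁ * (n₂ * (n₃ * n′ ^ 3)) * (O k * O j ^ 3)
        ≈⟨ Identities.ratio-chain series (O-ratio k) (O-ratio (suc k)) (O-ratio (suc (suc k)))
             (ratio-map (_^ 3) (^-congˡ 3) (Identities.cube-* series) refl refl (O-ratio j)) ⟨
      d₁ * (d₂ * (d₃ * d′ ^ 3)) * (O (3 +ⁿ k) * O (suc j) ^ 3)
        ≈⟨ *-congʳ (*-congˡ (*-congˡ (*-comm _ _))) ⟩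
      d₁ * (d₂ * (d′ ^ 3 * d₃)) * (O (3 +ⁿ k) * O (suc j) ^ 3)
        ≈⟨ gather d₃ (d′ ^ 3) d₂ d₁ _ ⟨
      d₃ * (d′ ^ 3 * (d₂ * (d₁ * (O (3 +ⁿ k) * O (suc j) ^ 3)))) ∎))))
    where
    k : ℕ
    k = j *ⁿ 3
    d₁ d₂ d₃ d′ n₁ n₂ n₃ n′ : Series
    d₁ = binomial (- 1#) (1 +ⁿ k)
    d₂ = binomial (- 1#) (2 +ⁿ k)
    d₃ = binomial (- 1#) (3 +ⁿ k)
    d′ = binomial (- 1#) (suc j)
    n₁ = binomial 1# (1 +ⁿ k)
    n₂ = binomial 1# (2 +ⁿ k)
    n₃ = binomial 1# (3 +ⁿ k)
    n′ = binomial 1# (suc j)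
    gather = Identities.gather series
    ratio-M : ∀ {d n d′ n′ f g} → M d ≈ d′ → M n ≈ n′ → d * f ≈ n * g → d′ * M f ≈ n′ * M g
    ratio-M = ratio-map M M-cong M-*
    cancel-cube : ∀ {f g} → d′ ^ 3 * f ≈ d′ ^ 3 * g → f ≈ g
    cancel-cube p = cancel-binomial j (cancel-binomial j (cancel-binomial j
      (trans (sym (Identities.cube-nested series d′ _)) (trans p (Identities.cube-nested series d′ _)))))

  -- Coefficient n of `M P` depends on P up to exponent 3n, hence the truncations at 3n and n.
  M-P : M P * V P ≈ P * P ^ 3
  M-P = coeffwise λ n → R.trans
    (agree-* (λ {i} i≤n → agree-^ 3 (P-agree (n *ⁿ 3)) (ℕ.*-monoˡ-≤ 3 i≤n)) (V-agree (P-agree n)) ℕ.≤-refl)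
    (R.trans (at (M-O n) n)
    (R.sym (agree-* (λ i≤n → P-agree (n *ⁿ 3) (ℕ.≤-trans i≤n (ℕ.m≤m*n n 3))) (agree-^ 3 (P-agree n)) ℕ.≤-refl)))

  -- By multiplicativity M θ is the inverse of M P, because θ is the inverse of P.
  M-θ : M θ ≈ θ ^ 4 * V P
  M-θ = Identities.M-θ-from-M-P series gauss
    (trans (sym (M-* θ P)) (trans (M-cong (trans (*-comm θ P) gauss)) M-1)) M-P

  -- With θ = a + X b and a, b series in q³, the part of θ⁵ on exponents divisible by 3 is a⁵ + 10
  -- a² X³ b³. Modulo 9 this is a² times the corresponding part of θ³, and a² = V (V θ ^ 2) comes
  -- out of `U`.
  U-θ⁵ : U (θ ^ 5) ≈ V θ ^ 2 * M θ
  U-θ⁵ = begin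
    U (θ ^ 5)                                            ≈⟨ U-cong expand ⟩
    U (V (V θ ^ 2) * θ ^ 3 + (X * h + X * (X * k)))      ≈⟨ U-+ _ _ ⟩
    U (V (V θ ^ 2) * θ ^ 3) + U (X * h + X * (X * k))    ≈⟨ +-cong (U-V-* _ _) (U-cubic {g = 0#} (sym pad) cubic-h cubic-k) ⟩
    V θ ^ 2 * M θ + 0#                                   ≈⟨ +-identityʳ _ ⟩
    V θ ^ 2 * M θ                                        ∎
    where
    a b h k : Series
    a = V (V θ)
    b = V (section 1 θ)
    h = 2 ×′ 1# * (a ^ 4 * b) + 5 ×′ 1# * (a * (X ^ 3 * b ^ 4))
    k = 7 ×′ 1# * (a ^ 3 * b ^ 2) + X ^ 3 * b ^ 5
    cubic-a : Cubic a
    cubic-a = cubic-V (V θ)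
    cubic-b : Cubic b
    cubic-b = cubic-V (section 1 θ)
    cubic-h : Cubic h
    cubic-h = cubic-+ (cubic-* (cubic-ℕ 2) (cubic-* (cubic-^ 4 cubic-a) cubic-b))
                      (cubic-* (cubic-ℕ 5) (cubic-* cubic-a (cubic-* cubic-X³ (cubic-^ 4 cubic-b))))
    cubic-k : Cubic k
    cubic-k = cubic-+ (cubic-* (cubic-ℕ 7) (cubic-* (cubic-^ 3 cubic-a) (cubic-^ 2 cubic-b)))
                      (cubic-* cubic-X³ (cubic-^ 5 cubic-b))
    pad : V 0# + X * h + X * (X * k) ≈ X * h + X * (X * k)
    pad = +-congʳ (trans (+-congʳ V-0) (+-identityˡ _))
    expand : θ ^ 5 ≈ V (V θ ^ 2) * θ ^ 3 + (X * h + X * (X * k))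
    expand = begin
      θ ^ 5                                                  ≈⟨ ^-congˡ 5 trisect-θ ⟩
      (a + X * b) ^ 5                                        ≈⟨ Identities.fifth-power series a X b ⟩
      a ^ 2 * (a + X * b) ^ 3 + 9 ×′ 1# * (a ^ 2 * (X * b) ^ 3) + (X * h + X * (X * k))
        ≈⟨ +-congʳ (trans (+-congˡ (9*≈0 _)) (+-identityʳ _)) ⟩
      a ^ 2 * (a + X * b) ^ 3 + (X * h + X * (X * k))        ≈⟨ +-congʳ (*-cong (sym (V-^ (V θ) 2)) (^-congˡ 3 (sym trisect-θ))) ⟩
      V (V θ ^ 2) * θ ^ 3 + (X * h + X * (X * k))            ∎

  VP-Vθ : V P * V θ ≈ 1#
  VP-Vθ = trans (sym (V-* P θ)) (trans (V-cong gauss) (V-const R.1#))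

  U-P³ : U (P ^ 3) ≈ V (P ^ 2) * θ ^ 5
  U-P³ = trans (Identities.M-P-reduced series gauss VP-Vθ (ninth-power θ) M-P) (*-congʳ (sym (V-^ P 2)))

  U²-P³ : U (U (P ^ 3)) ≈ V θ * θ ^ 2
  U²-P³ = begin
    U (U (P ^ 3))                             ≈⟨ U-cong U-P³ ⟩
    U (V (P ^ 2) * θ ^ 5)                     ≈⟨ U-V-* _ _ ⟩
    P ^ 2 * U (θ ^ 5)                         ≈⟨ *-congˡ (trans U-θ⁵ (*-congˡ M-θ)) ⟩
    P ^ 2 * (V θ ^ 2 * (θ ^ 4 * V P))         ≈⟨ Identities.U²-reduced series gauss VP-Vθ ⟩
    V θ * θ ^ 2                               ∎

  limit : Series
  limit = V (θ ^ 2) * θ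

  U-Vθ*θ² : U (V θ * θ ^ 2) ≈ limit
  U-Vθ*θ² = begin
    U (V θ * θ ^ 2)  ≈⟨ U-V-* _ _ ⟩
    θ * U (θ ^ 2)    ≈⟨ *-congˡ (trans U-θ² (sym (V-^ θ 2))) ⟩
    θ * V (θ ^ 2)    ≈⟨ *-comm _ _ ⟩
    limit            ∎

  U³-P³ : U (U (U (P ^ 3))) ≈ limit
  U³-P³ = trans (U-cong U²-P³) U-Vθ*θ²

  -- `U` interchanges V (θ²) θ and V θ · θ², because U θ = V θ and U (θ²) = V (θ²).
  U²-limit : U (U limit) ≈ limit
  U²-limit = trans (U-cong (trans (U-V-* _ _) (trans (*-congˡ U-θ) (*-comm _ _)))) U-Vθ*θ²

  P³-vanishes : ∀ α n → (P ^ 3) (3 ^ⁿ (2 *ⁿ suc α +ⁿ 1) *ⁿ (3 *ⁿ n +ⁿ 2)) R.≈ R.0#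
  P³-vanishes = vanishes {f = P ^ 3} U³-P³ U²-limit (section-2-V*θ (θ ^ 2))

-- Congruences modulo 16

module ModSixteen {c ℓ} (R : CommutativeRing c ℓ) (16≈0 : Annihilates R 16) where

  private
    module R = CommutativeRing R
  open PowerSeries R
  open Trisection R
  open Gauss R
  open CommutativeRing series hiding (zero)
  open Exp semiring using (_^_)
  open Mult semiring using () renaming (_×_ to _×′_)

  opaque
    unfolding _⊕_

    16*≈0 : ∀ f → 16 ×′ 1# * f ≈ 0#
    16*≈0 f = trans (*-congʳ (coeffwise λ n → 16≈0 (const R.1# n))) (zeroˡ f)

  limit : Series
  limit = θ + 2 ×′ 1# * θ ^ 2 + 2 ×′ 1# * (- 1#)

  P³≈limit : P ^ 3 ≈ limit
  P³≈limit = Identities.cube-mod-16 series (-‿inverseʳ 1#) 16*≈0 gauss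

  V-2* : ∀ f → V (2 ×′ 1# * f) ≈ 2 ×′ 1# * V f
  V-2* f = trans (V-* _ _) (*-congʳ (trans (V-+ _ _) (+-cong (V-const R.1#) (V-const R.1#))))

  U-2* : ∀ f → U (2 ×′ 1# * f) ≈ 2 ×′ 1# * U f
  U-2* f = trans (U-cong (*-congʳ (sym (trans (V-+ _ _) (+-cong (V-const R.1#) (V-const R.1#)))))) (U-V-* _ f)

  V-neg-1 : V (- 1#) ≈ - 1#
  V-neg-1 = trans (V-neg 1#) (-‿cong (V-const R.1#))

  U-limit : U limit ≈ V limit
  U-limit = trans
    (trans (U-+ _ _) (+-cong (trans (U-+ _ _) (+-cong U-θ (trans (U-2* _) (*-congˡ (trans U-θ² (sym (V-^ θ 2)))))))
      (trans (U-2* _) (*-congˡ (trans (U-cong (sym V-neg-1)) (trans (U-V _) (sym V-neg-1)))))))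
    (sym (trans (V-+ _ _) (+-cong (trans (V-+ _ _) (+-congˡ (V-2* _))) (V-2* _))))

  U²-limit : U (U limit) ≈ limit
  U²-limit = trans (U-cong U-limit) (U-V limit)

  P³-vanishes : ∀ α n → (P ^ 3) (3 ^ⁿ (2 *ⁿ suc α +ⁿ 1) *ⁿ (3 *ⁿ n +ⁿ 2)) R.≈ R.0#
  P³-vanishes = vanishes {f = P ^ 3}
    -- Here g is `V limit`: U² fixes `limit` and the third `U` acts as `V`. As a series in q³, g has
    -- no exponents 2 modulo 3.
    (trans (U-cong (U-cong (U-cong P³≈limit))) (trans (U-cong U²-limit) U-limit))
    (trans (U-cong (U-V limit)) U-limit)
    (section-2-V limit)

-- Natural numbers under congruence as coefficient ring, and the conclusion

module Modular (k : ℕ) where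

  m : ℕ
  m = suc k

  _≡ₘ_ : ℕ → ℕ → Set
  a ≡ₘ b = a % m ≡ b % m

  +-cong : ∀ {a b a′ b′} → a ≡ₘ a′ → b ≡ₘ b′ → (a +ⁿ b) ≡ₘ (a′ +ⁿ b′)
  +-cong {a} {b} {a′} {b′} p r =
    ≡.trans (%-distribˡ-+ a b m) (≡.trans (≡.cong₂ (λ x y → (x +ⁿ y) % m) p r) (≡.sym (%-distribˡ-+ a′ b′ m)))

  *-cong : ∀ {a b a′ b′} → a ≡ₘ a′ → b ≡ₘ b′ → (a *ⁿ b) ≡ₘ (a′ *ⁿ b′)
  *-cong {a} {b} {a′} {b′} p r =
    ≡.trans (%-distribˡ-* a b m) (≡.trans (≡.cong₂ (λ x y → (x *ⁿ y) % m) p r) (≡.sym (%-distribˡ-* a′ b′ m)))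

  -- The additive inverse of x is represented by (m − 1) x.
  inverseʳ : ∀ x → (x +ⁿ k *ⁿ x) ≡ₘ 0
  inverseʳ x = ≡.trans (≡.cong (_% m) (ℕ.*-comm m x)) (m*n%n≡0 x m)

  -- The carrier stays ℕ and only the equality is coarsened, so the coefficients of P remain the
  -- overpartition numbers and equality with 0 is divisibility.
  ring : CommutativeRing 0ℓ 0ℓ
  ring = record
    { Carrier = ℕ ; _≈_ = _≡ₘ_ ; _+_ = _+ⁿ_ ; _*_ = _*ⁿ_ ; -_ = k *ⁿ_ ; 0# = 0 ; 1# = 1
    ; isCommutativeRing = record
      { isRing = record
        { +-isAbelianGroup = record
          { isGroup = record
            { isMonoid = record
              { isSemigroup = record
                { isMagma = record
                  { isEquivalence = record { refl = ≡.refl ; sym = ≡.sym ; trans = ≡.trans }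
                  ; ∙-cong = λ {a} {a′} {b} {b′} → +-cong {a} {b} {a′} {b′}
                  }
                ; assoc = λ a b d → ≡.cong (_% m) (ℕ.+-assoc a b d)
                }
              ; identity = (λ _ → ≡.refl) , (λ a → ≡.cong (_% m) (ℕ.+-identityʳ a))
              }
            ; inverse = (λ a → ≡.trans (≡.cong (_% m) (ℕ.+-comm (k *ⁿ a) a)) (inverseʳ a)) , inverseʳ
            ; ⁻¹-cong = λ {a} {b} → *-cong {k} {a} {k} {b} ≡.refl
            }
          ; comm = λ a b → ≡.cong (_% m) (ℕ.+-comm a b)
          }
        ; *-cong = λ {a} {a′} {b} {b′} → *-cong {a} {b} {a′} {b′}
        ; *-assoc = λ a b d → ≡.cong (_% m) (ℕ.*-assoc a b d)
        ; *-identity = (λ a → ≡.cong (_% m) (ℕ.*-identityˡ a)) , (λ a → ≡.cong (_% m) (ℕ.*-identityʳ a))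
        ; distrib = (λ a b d → ≡.cong (_% m) (ℕ.*-distribˡ-+ a b d)) , (λ a b d → ≡.cong (_% m) (ℕ.*-distribʳ-+ a b d))
        }
      ; *-comm = λ a b → ≡.cong (_% m) (ℕ.*-comm a b)
      }
    }

  open CommutativeRing ring using (semiring)
  open RMult semiring renaming (_×_ to _×ᴿ_)
  open Mult semiring renaming (_×_ to _×′_)

  ×1 : ∀ n → n ×ᴿ 1 ≡ n
  ×1 zero    = ≡.refl
  ×1 (suc n) = ≡.cong suc (×1 n)

  ×′≡* : ∀ j x → j ×′ x ≡ x *ⁿ j
  ×′≡* 0             x = ≡.sym (ℕ.*-zeroʳ x)
  ×′≡* 1             x = ≡.sym (ℕ.*-identityʳ x)
  ×′≡* (suc (suc j)) x = ≡.trans (≡.cong (_+ⁿ x) (×′≡* (suc j) x))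
                           (≡.trans (ℕ.+-comm _ x) (≡.sym (ℕ.*-suc x (suc j))))

  m≈0 : Annihilates ring m
  m≈0 x = ≡.trans (≡.cong (_% m) (×′≡* m x)) (m*n%n≡0 x m)

  fermat : FermatCube ring
  fermat x = third x , ≡.cong (_% m) (exact x)
    where
    -- (n³ - n) / 3, summed from the increments ((n+1)³ - (n+1) - (n³ - n)) / 3 = n² + n.
    third : ℕ → ℕ
    third zero    = 0
    third (suc n) = third n +ⁿ (n *ⁿ n +ⁿ n)
    exact : ∀ n → n *ⁿ (n *ⁿ n) ≡ n +ⁿ (third n +ⁿ third n +ⁿ third n)
    exact zero    = ≡.refl
    exact (suc n) = begin
      suc n *ⁿ (suc n *ⁿ suc n)
        ≡⟨ solve 1 (λ n → (con 1 :+ n) :* ((con 1 :+ n) :* (con 1 :+ n)) :=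
             n :* (n :* n) :+ con 3 :* (n :* n :+ n) :+ con 1) ≡.refl n ⟩
      n *ⁿ (n *ⁿ n) +ⁿ 3 *ⁿ (n *ⁿ n +ⁿ n) +ⁿ 1
        ≡⟨ ≡.cong (λ x → x +ⁿ 3 *ⁿ (n *ⁿ n +ⁿ n) +ⁿ 1) (exact n) ⟩
      n +ⁿ (third n +ⁿ third n +ⁿ third n) +ⁿ 3 *ⁿ (n *ⁿ n +ⁿ n) +ⁿ 1
        ≡⟨ solve 2 (λ n t → n :+ (t :+ t :+ t) :+ con 3 :* (n :* n :+ n) :+ con 1 :=
             con 1 :+ n :+ ((t :+ (n :* n :+ n)) :+ (t :+ (n :* n :+ n)) :+ (t :+ (n :* n :+ n)))) ≡.refl n (third n) ⟩
      suc n +ⁿ (third (suc n) +ⁿ third (suc n) +ⁿ third (suc n)) ∎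
      where
      open ≡-Reasoning
      open NatSolver.+-*-Solver

  open PowerSeries ring using (at; series)
  open Exp (CommutativeRing.semiring series) using (_^_)
  open Gauss ring using (P; ι-pbar3)

  divides-pbar3 : ∀ n → (P ^ 3) n ≡ₘ 0 → m ∣ pbar3 n
  divides-pbar3 n p = m%n≡0⇒n∣m (pbar3 n) m
    (≡.trans (≡.cong (_% m) (≡.sym (×1 (pbar3 n)))) (≡.trans (at ι-pbar3 n) p))

open import Data.Nat using (_+_; _*_; _^_)

theorem3p7 : (α n : ℕ) → 144 ∣ pbar3 (3 ^ (2 * suc α + 1) * (3 * n + 2))
theorem3p7 α n = lcm-least
  -- `Modular` takes the predecessor of the modulus; 9 and 16 are coprime, so `lcm 9 16` is 144.
  (Modular.divides-pbar3 8 N (ModNine.P³-vanishes (Modular.ring 8) (Modular.m≈0 8) (Modular.fermat 8) α n))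
  (Modular.divides-pbar3 15 N (ModSixteen.P³-vanishes (Modular.ring 15) (Modular.m≈0 15) α n))
  where
  N : ℕ
  N = 3 ^ (2 * suc α + 1) * (3 * n + 2)
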